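{- Let $p$ be an odd prime, let $G=\langle a,b,c \mid a^p=b^p=c^p=1,\ [a,b]=c,\ [c,a]=[c,b]=1\rangle$, and let $S=\{a^i,b^i\mid 1\leq i\leq p-1\}$. Let $\mathrm{Cos}(G,\langle a\rangle,\langle b\rangle)$ be the graph with vertex set $\{\langle a\rangle g\mid g\in G\}\cup\{\langle b\rangle h\mid h\in G\}$ and with edges all the coset pairs $\{\langle a\rangle g,\langle b\rangle h\}$ having non-empty intersection in $G$ (that is, $\langle a\rangle g\cap\langle b\rangle h\neq\emptyset$). Then $\mathrm{Cay}(G,S)$ is the line graph of $\mathrm{Cos}(G,\langle a\rangle,\langle b\rangle)$, and $\mathrm{Cos}(G,\langle a\rangle,\langle b\rangle)$ is $3$-arc-transitive.
   Context: All graphs are finite, simple and undirected. Here $[x,y]=x^{ -1}y^{ -1}xy$. For a finite group $G$ and $S\subseteq G\setminus\{1\}$ with $S=S^{ -1}$, the Cayley graph $\mathrm{Cay}(G,S)$ has vertex set $G$, with $g,h$ adjacent if and only if $hg^{ -1}\in S$. The line graph of a graph $\Sigma$ has the edges of $\Sigma$ as vertices, two distinct edges being adjacent when they share an endpoint; "is the line graph" is understood up to graph isomorphism. An $s$-arc of a graph $\Sigma$ is a sequence $v_0,v_1,\dots,v_s$ of vertices such that $v_{i-1},v_i$ are adjacent for $1\le i\le s$ and $v_{i-1}\neq v_{i+1}$ for $1\le i\le s-1$. $\Sigma$ is $s$-arc-transitive if it has at least one $s$-arc and its full automorphism group $\mathrm{Aut}(\Sigma)$ is transitive on the set of $s$-arcs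 of $\Sigma$. -}

module Defs where

open import Level using (Level; 0ℓ; _⊔_)
open import Algebra.Bundles using (Group; RawGroup)
import Algebra.Definitions.RawMonoid as RawMonoidDefs
import Algebra.Properties.Group as GroupProperties
import Algebra.Properties.Monoid.Mult as MonoidMult
open import Data.Fin.Base using (Fin; toℕ)
open import Data.Integer.Base as ℤ using (ℤ; +_; 0ℤ; 1ℤ)
import Data.Integer.Properties as ℤₚ
open import Data.Integer.Divisibility.Signed as ℤ∣ₛ using (divides)
open import Data.Integer.Tactic.RingSolver using (solve-∀)
open import Data.Nat.Base as ℕ using (ℕ; zero; suc; s≤s; _≤_; _∸_)
import Data.Nat.Divisibility as ℕ∣
import Data.Nat.Properties as ℕₚ
open import Data.Nat.Primality using (Prime; ¬prime[1])
open import Data.Product.Base using (Σ-syntax; ∃-syntax; _×_; _,_; proj₁; proj₂)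
open import Data.Sum.Base as Sum using (_⊎_; inj₁; inj₂)
open import Function.Bundles using (Inverse; _⇔_)
open import Relation.Nullary.Negation using (¬_)
open import Relation.Binary.Bundles using (Setoid)
open import Relation.Binary.Core using (Rel)
open import Relation.Binary.Definitions using (Symmetric; Irreflexive; _Respects₂_)
open import Relation.Binary.PropositionalEquality as ≡ using (_≡_)
open import Relation.Unary using (Pred; _∈_; _∉_; _∩_; _≐_; Satisfiable)

private variable
  o ℓ e r o′ ℓ′ e′ h k : Level

-- Vertices form a setoid, so that vertex sets of cosets and of unordered
-- pairs can be expressed.  Finiteness is not a field: no definition below
-- depends on it.

record Graph o ℓ e : Set (Level.suc (o ⊔ ℓ ⊔ e)) where
  field
    vertices : Setoid o ℓ
  open Setoid vertices public
    renaming (Carrier to Vertex; refl to ≈-refl; sym to ≈-sym; trans to ≈-trans)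
    using (_≈_; _≉_)
  field
    Adj     : Rel Vertex e
    resp    : Adj Respects₂ _≈_
    symm    : Symmetric Adj
    irrefl  : Irreflexive _≈_ Adj

record _≅_ (Γ : Graph o ℓ e) (Δ : Graph o′ ℓ′ e′) : Set (o ⊔ ℓ ⊔ e ⊔ o′ ⊔ ℓ′ ⊔ e′) where
  private
    module Γ = Graph Γ
    module Δ = Graph Δ
  field
    bijection : Inverse Γ.vertices Δ.vertices
  open Inverse bijection public using (to; from)
  field
    adj⇔ : ∀ u v → Γ.Adj u v ⇔ Δ.Adj (to u) (to v)

Aut : Graph o ℓ e → Set (o ⊔ ℓ ⊔ e)
Aut Γ = Γ ≅ Γ

module _ (Γ : Graph o ℓ e) where
  open Graph Γ

  record Arc (s : ℕ) : Set (o ⊔ ℓ ⊔ e) where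
    field
      at          : Fin (suc s) → Vertex
      consecutive : ∀ i j → toℕ j ≡ 1 ℕ.+ toℕ i → Adj (at i) (at j)
      noBacktrack : ∀ i j → toℕ j ≡ 2 ℕ.+ toℕ i → at i ≉ at j

  record ArcTransitive (s : ℕ) : Set (o ⊔ ℓ ⊔ e) where
    field
      arc        : Arc s
      transitive : ∀ (α β : Arc s) →
                   Σ[ φ ∈ Aut Γ ] (∀ i → _≅_.to φ (Arc.at α i) ≈ Arc.at β i)

  -- An edge is stored as an ordered pair of adjacent vertices; _≈ᵉ_ forgets
  -- the order.
  Edge : Set (o ⊔ e)
  Edge = Σ[ u ∈ Vertex ] Σ[ v ∈ Vertex ] Adj u v

  _≈ᵉ_ : Rel Edge ℓ
  (u , v , _) ≈ᵉ (u′ , v′ , _) = (u ≈ u′ × v ≈ v′) ⊎ (u ≈ v′ × v ≈ u′)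

  _IsEndOf_ : Vertex → Edge → Set ℓ
  w IsEndOf (u , v , _) = w ≈ u ⊎ w ≈ v

  private
    ≈ᵉ-sym : Symmetric _≈ᵉ_
    ≈ᵉ-sym (inj₁ (p , q)) = inj₁ (≈-sym p , ≈-sym q)
    ≈ᵉ-sym (inj₂ (p , q)) = inj₂ (≈-sym q , ≈-sym p)

    ≈ᵉ-trans : ∀ {x y z} → x ≈ᵉ y → y ≈ᵉ z → x ≈ᵉ z
    ≈ᵉ-trans (inj₁ (p , q)) (inj₁ (p′ , q′)) = inj₁ (≈-trans p p′ , ≈-trans q q′)
    ≈ᵉ-trans (inj₁ (p , q)) (inj₂ (p′ , q′)) = inj₂ (≈-trans p p′ , ≈-trans q q′)
    ≈ᵉ-trans (inj₂ (p , q)) (inj₁ (p′ , q′)) = inj₂ (≈-trans p q′ , ≈-trans q p′)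
    ≈ᵉ-trans (inj₂ (p , q)) (inj₂ (p′ , q′)) = inj₁ (≈-trans p q′ , ≈-trans q p′)

    end-resp : ∀ {w x y} → x ≈ᵉ y → w IsEndOf x → w IsEndOf y
    end-resp (inj₁ (p , q)) (inj₁ t) = inj₁ (≈-trans t p)
    end-resp (inj₁ (p , q)) (inj₂ t) = inj₂ (≈-trans t q)
    end-resp (inj₂ (p , q)) (inj₁ t) = inj₂ (≈-trans t p)
    end-resp (inj₂ (p , q)) (inj₂ t) = inj₁ (≈-trans t q)

  LineGraph : Graph (o ⊔ e) ℓ (o ⊔ ℓ)
  LineGraph = record
    { vertices = record
      { Carrier = Edge
      ; _≈_ = _≈ᵉ_
      ; isEquivalence = record
        { refl  = inj₁ (≈-refl , ≈-refl)
        ; sym   = λ {x} {y} → ≈ᵉ-sym {x} {y}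
        ; trans = λ {x} {y} {z} → ≈ᵉ-trans {x} {y} {z}
        }
      }
    ; Adj = λ x y → ¬ (x ≈ᵉ y) × ∃[ w ] (w IsEndOf x × w IsEndOf y)
    ; resp =
        (λ {x} {y} {z} y≈z (x≉y , w , wx , wy) →
          (λ x≈z → x≉y (≈ᵉ-trans {x} {z} {y} x≈z (≈ᵉ-sym {y} {z} y≈z))) ,
          w , wx , end-resp {w} {y} {z} y≈z wy)
      , (λ {x} {y} {z} y≈z (y≉x , w , wy , wx) →
          (λ z≈x → y≉x (≈ᵉ-trans {y} {z} {x} y≈z z≈x)) ,
          w , end-resp {w} {y} {z} y≈z wy , wx)
    ; symm = λ {x} {y} (x≉y , w , wx , wy) →
        (λ y≈x → x≉y (≈ᵉ-sym {y} {x} y≈x)) , w , wy , wx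
    ; irrefl = λ x≈y (x≉y , _) → x≉y x≈y
    }

module RawGroupOps (G : RawGroup o ℓ) where
  open RawGroup G

  infixr 8 _^_

  -- The library's iterated operation is written additively.
  _^_ : Carrier → ℕ → Carrier
  x ^ n = RawMonoidDefs._×_ rawMonoid n x

  [_,_] : Carrier → Carrier → Carrier
  [ x , y ] = x ⁻¹ ∙ y ⁻¹ ∙ x ∙ y

data Term (X : Set) : Set where
  gen  : X → Term X
  1ᵗ   : Term X
  _∙ᵗ_ : Term X → Term X → Term X
  _⁻¹ᵗ : Term X → Term X

infixl 7 _∙ᵗ_
infix  8 _⁻¹ᵗ

termRawGroup : Set → RawGroup 0ℓ 0ℓ
termRawGroup X = record
  { Carrier = Term X ; _≈_ = _≡_ ; _∙_ = _∙ᵗ_ ; ε = 1ᵗ ; _⁻¹ = _⁻¹ᵗ }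

module _ {X : Set} (R : Rel (Term X) 0ℓ) where

  -- Equality in the group ⟨ X ∣ s = t for R s t ⟩: the least congruence
  -- containing R and the group axioms.
  data Derivable : Rel (Term X) 0ℓ where
    relᵈ   : ∀ {s t} → R s t → Derivable s t
    reflᵈ  : ∀ {s} → Derivable s s
    symᵈ   : ∀ {s t} → Derivable s t → Derivable t s
    transᵈ : ∀ {s t u} → Derivable s t → Derivable t u → Derivable s u
    ∙-congᵈ  : ∀ {s s′ t t′} → Derivable s s′ → Derivable t t′ → Derivable (s ∙ᵗ t) (s′ ∙ᵗ t′)
    ⁻¹-congᵈ : ∀ {s t} → Derivable s t → Derivable (s ⁻¹ᵗ) (t ⁻¹ᵗ)
    assocᵈ     : ∀ s t u → Derivable ((s ∙ᵗ t) ∙ᵗ u) (s ∙ᵗ (t ∙ᵗ u))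
    identityˡᵈ : ∀ s → Derivable (1ᵗ ∙ᵗ s) s
    identityʳᵈ : ∀ s → Derivable (s ∙ᵗ 1ᵗ) s
    inverseˡᵈ  : ∀ s → Derivable (s ⁻¹ᵗ ∙ᵗ s) 1ᵗ
    inverseʳᵈ  : ∀ s → Derivable (s ∙ᵗ s ⁻¹ᵗ) 1ᵗ

  presentedGroup : Group 0ℓ 0ℓ
  presentedGroup = record
    { Carrier = Term X
    ; _≈_ = Derivable
    ; _∙_ = _∙ᵗ_
    ; ε = 1ᵗ
    ; _⁻¹ = _⁻¹ᵗ
    ; isGroup = record
      { isMonoid = record
        { isSemigroup = record
          { isMagma = record
            { isEquivalence = record { refl = reflᵈ ; sym = symᵈ ; trans = transᵈ }
            ; ∙-cong = ∙-congᵈ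
            }
          ; assoc = assocᵈ
          }
        ; identity = identityˡᵈ , identityʳᵈ
        }
      ; inverse = inverseˡᵈ , inverseʳᵈ
      ; ⁻¹-cong = ⁻¹-congᵈ
      }
    }

record ConnectionSet (G : Group o ℓ) r : Set (o ⊔ ℓ ⊔ Level.suc r) where
  open Group G
  field
    S       : Pred Carrier r
    S-resp  : ∀ {x y} → x ≈ y → x ∈ S → y ∈ S
    ε∉S     : ε ∉ S
    S⁻¹⊆S   : ∀ {x} → x ∈ S → x ⁻¹ ∈ S

module _ (G : Group o ℓ) where
  open Group G
  open GroupProperties G

  Cay : ConnectionSet G r → Graph o ℓ r
  Cay conn = record
    { vertices = setoid
    ; Adj = λ g h → h ∙ g ⁻¹ ∈ S
    ; resp = (λ h≈h′ → S-resp (∙-congʳ h≈h′))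
           , (λ g≈g′ → S-resp (∙-congˡ (⁻¹-cong g≈g′)))
    ; symm = λ {g} {h} s → S-resp
        (trans (⁻¹-anti-homo-∙ h (g ⁻¹)) (∙-congʳ (⁻¹-involutive g))) (S⁻¹⊆S s)
    ; irrefl = λ {g} {h} g≈h s → ε∉S
        (S-resp (trans (∙-congʳ (sym g≈h)) (inverseʳ g)) s)
    }
    where open ConnectionSet conn

record Subgroup (G : Group o ℓ) h : Set (o ⊔ ℓ ⊔ Level.suc h) where
  open Group G
  field
    Mem       : Pred Carrier h
    Mem-resp  : ∀ {x y} → x ≈ y → x ∈ Mem → y ∈ Mem
    ε-mem     : ε ∈ Mem
    ∙-mem     : ∀ {x y} → x ∈ Mem → y ∈ Mem → x ∙ y ∈ Mem
    ⁻¹-mem    : ∀ {x} → x ∈ Mem → x ⁻¹ ∈ Mem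

module _ (G : Group o ℓ) where
  open Group G

  -- The least subgroup containing x.
  data Generated (x : Carrier) : Pred Carrier (o ⊔ ℓ) where
    base  : Generated x x
    unit  : Generated x ε
    prod  : ∀ {y z} → Generated x y → Generated x z → Generated x (y ∙ z)
    inv   : ∀ {y} → Generated x y → Generated x (y ⁻¹)
    ≈-resp : ∀ {y z} → y ≈ z → Generated x y → Generated x z

  ⟨_⟩ : Carrier → Subgroup G (o ⊔ ℓ)
  ⟨ x ⟩ = record
    { Mem = Generated x ; Mem-resp = ≈-resp ; ε-mem = unit ; ∙-mem = prod ; ⁻¹-mem = inv }

  infix 6 _·_

  _·_ : Subgroup G h → Carrier → Pred Carrier (o ⊔ ℓ ⊔ h)
  (H · g) x = ∃[ y ] (y ∈ Subgroup.Mem H × x ≈ y ∙ g)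

module _ (G : Group o ℓ) (H K : Subgroup G h) where
  open Group G
  private
    module H = Subgroup H
    module K = Subgroup K

  data Coset : Set o where
    left right : Carrier → Coset

  ⟦_⟧ : Coset → Pred Carrier (o ⊔ ℓ ⊔ h)
  ⟦ left g ⟧  = _·_ G H g
  ⟦ right g ⟧ = _·_ G K g

  -- Vertices are compared as subsets of G, whatever their tags, so that the
  -- vertex set is the union, rather than the disjoint union, of the two
  -- families of cosets.
  _≈ᶜ_ : Rel Coset (o ⊔ ℓ ⊔ h)
  u ≈ᶜ v = ⟦ u ⟧ ≐ ⟦ v ⟧

  CosAdj : Rel Coset (o ⊔ ℓ ⊔ h)
  CosAdj u v =
    (∃[ g ] ∃[ k ] ((u ≈ᶜ left g × v ≈ᶜ right k) ⊎ (u ≈ᶜ right k × v ≈ᶜ left g)))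
    × Satisfiable (⟦ u ⟧ ∩ ⟦ v ⟧)

  private
    ≈ᶜ-refl : ∀ {u} → u ≈ᶜ u
    ≈ᶜ-refl = (λ m → m) , (λ m → m)

    ≈ᶜ-sym : ∀ {u v} → u ≈ᶜ v → v ≈ᶜ u
    ≈ᶜ-sym (p , q) = q , p

    ≈ᶜ-trans : ∀ {u v w} → u ≈ᶜ v → v ≈ᶜ w → u ≈ᶜ w
    ≈ᶜ-trans (p , q) (p′ , q′) = (λ m → p′ (p m)) , (λ m → q (q′ m))

    CosAdj-sym : ∀ {u v} → CosAdj u v → CosAdj v u
    CosAdj-sym ((g , k , inj₁ (p , q)) , x , m , n) = (g , k , inj₂ (q , p)) , x , n , m
    CosAdj-sym ((g , k , inj₂ (p , q)) , x , m , n) = (g , k , inj₁ (q , p)) , x , n , m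

    CosAdj-respʳ : ∀ {u v w} → v ≈ᶜ w → CosAdj u v → CosAdj u w
    CosAdj-respʳ {u} {v} {w} e ((g , k , inj₁ (p , q)) , x , m , n) =
      (g , k , inj₁ (p , ≈ᶜ-trans {w} {v} {right k} (≈ᶜ-sym {v} {w} e) q)) , x , m , proj₁ e n
    CosAdj-respʳ {u} {v} {w} e ((g , k , inj₂ (p , q)) , x , m , n) =
      (g , k , inj₂ (p , ≈ᶜ-trans {w} {v} {left g} (≈ᶜ-sym {v} {w} e) q)) , x , m , proj₁ e n

  private
    open GroupProperties G
    open import Relation.Binary.Reasoning.Setoid setoid

    coset⊆⇒⊆ : ∀ (A B : Subgroup G h) {g k} →
               (∀ {x} → x ∈ _·_ G A g → x ∈ _·_ G B k) →
               ∀ {x} → x ∈ Subgroup.Mem A → x ∈ Subgroup.Mem B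
    coset⊆⇒⊆ A B {g} {k} sub {x} x∈A
      with sub (ε , Subgroup.ε-mem A , refl) | sub (x , x∈A , refl)
    ... | y , y∈B , εg≈yk | z , z∈B , xg≈zk =
      B.Mem-resp (sym eq) (B.∙-mem z∈B (B.⁻¹-mem y∈B))
      where
      module B = Subgroup B
      eq : x ≈ z ∙ y ⁻¹
      eq = ∙-cancelʳ g x (z ∙ y ⁻¹) (begin
        x ∙ g                   ≈⟨ xg≈zk ⟩
        z ∙ k                   ≈⟨ ∙-congˡ (\\-leftDividesʳ y k) ⟨
        z ∙ (y ⁻¹ ∙ (y ∙ k))    ≈⟨ ∙-congˡ (∙-congˡ εg≈yk) ⟨
        z ∙ (y ⁻¹ ∙ (ε ∙ g))    ≈⟨ ∙-congˡ (∙-congˡ (identityˡ g)) ⟩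
        z ∙ (y ⁻¹ ∙ g)          ≈⟨ assoc z (y ⁻¹) g ⟨
        z ∙ y ⁻¹ ∙ g            ∎)

  left≈right⇒H≐K : ∀ {g k} → left g ≈ᶜ right k → H.Mem ≐ K.Mem
  left≈right⇒H≐K (p , q) = coset⊆⇒⊆ H K p , coset⊆⇒⊆ K H q

  -- For H = K the relation CosAdj would have loops.
  Cos : ¬ (H.Mem ≐ K.Mem) → Graph o (o ⊔ ℓ ⊔ h) (o ⊔ ℓ ⊔ h)
  Cos H≢K = record
    { vertices = record
      { Carrier = Coset
      ; _≈_ = _≈ᶜ_
      ; isEquivalence = record
        { refl  = λ {u} → ≈ᶜ-refl {u}
        ; sym   = λ {u} {v} → ≈ᶜ-sym {u} {v}
        ; trans = λ {u} {v} {w} → ≈ᶜ-trans {u} {v} {w}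
        }
      }
    ; Adj = CosAdj
    ; resp = (λ {u} {v} {w} → CosAdj-respʳ {u} {v} {w})
           , (λ {u} {v} {w} e a →
               CosAdj-sym {u} {w} (CosAdj-respʳ {u} {v} {w} e (CosAdj-sym {v} {u} a)))
    ; symm = λ {u} {v} → CosAdj-sym {u} {v}
    ; irrefl = λ {u} {v} → irr {u} {v}
    }
    where
    irr : ∀ {u v} → u ≈ᶜ v → ¬ CosAdj u v
    irr {u} {v} e ((g , k , inj₁ (p , q)) , _) = H≢K (left≈right⇒H≐K {g} {k}
      (≈ᶜ-trans {left g} {u} {right k} (≈ᶜ-sym {u} {left g} p) (≈ᶜ-trans {u} {v} {right k} e q)))
    irr {u} {v} e ((g , k , inj₂ (p , q)) , _) = H≢K (left≈right⇒H≐K {g} {k}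
      (≈ᶜ-trans {left g} {v} {right k} (≈ᶜ-sym {v} {left g} q)
        (≈ᶜ-trans {v} {u} {right k} (≈ᶜ-sym {u} {v} e) p)))

data Gen : Set where
  a′ b′ c′ : Gen

a b c : Term Gen
a  = gen a′
b  = gen b′
c = gen c′

module _ (p : ℕ) where
  open RawGroupOps (termRawGroup Gen)

  data Relator : Rel (Term Gen) 0ℓ where
    aᵖ≡1    : Relator (a ^ p) 1ᵗ
    bᵖ≡1    : Relator (b ^ p) 1ᵗ
    cᵖ≡1    : Relator (c ^ p) 1ᵗ
    [a,b]≡c : Relator [ a , b ] c
    [c,a]≡1 : Relator [ c , a ] 1ᵗ
    [c,b]≡1 : Relator [ c , b ] 1ᵗ

  G : Group 0ℓ 0ℓ
  G = presentedGroup Relator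

module _ (p : ℕ) where
  private
    module G = Group (G p)
    module T = RawGroupOps (termRawGroup Gen)
    open RawGroupOps G.rawGroup
    open MonoidMult G.monoid using (×-homo-+)
    open GroupProperties (G p) using (inverseʳ-unique)

  S : Pred (Term Gen) 0ℓ
  S g = ∃[ i ] (1 ≤ i × i ≤ p ∸ 1 × (g G.≈ a ^ i ⊎ g G.≈ b ^ i))

  ^-agree : ∀ x n → x ^ n ≡ x T.^ n
  ^-agree x zero    = ≡.refl
  ^-agree x (suc n) = ≡.cong (x ∙ᵗ_) (^-agree x n)

  -- Exponent sums modulo p are invariants of elements of G.
  module Weight (α β : ℤ) where
    w : Term Gen → ℤ
    w (gen a′) = α
    w (gen b′) = β
    w (gen c′) = 0ℤ
    w 1ᵗ       = 0ℤ
    w (s ∙ᵗ t) = w s ℤ.+ w t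
    w (s ⁻¹ᵗ)  = ℤ.- w s

    _≋_ : Rel ℤ 0ℓ
    x ≋ y = ∃[ q ] x ≡ y ℤ.+ q ℤ.* + p

    ≡⇒≋ : ∀ {x y} → x ≡ y → x ≋ y
    ≡⇒≋ {x} ≡.refl = 0ℤ , ≡.sym (ℤₚ.+-identityʳ x)

    w-^ : ∀ x n → w (x T.^ n) ≡ + n ℤ.* w x
    w-^ x zero    = ≡.refl
    w-^ x (suc n) = ≡.trans (≡.cong (λ y → w x ℤ.+ y) (w-^ x n)) (≡.sym (ℤₚ.suc-* (+ n) (w x)))

    pow≋0 : ∀ x → w (x T.^ p) ≋ 0ℤ
    pow≋0 x = w x , ≡.trans (w-^ x p)
      (≡.trans (ℤₚ.*-comm (+ p) (w x)) (≡.sym (ℤₚ.+-identityˡ _)))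

    comm≡0 : ∀ x y → ℤ.- x ℤ.+ ℤ.- y ℤ.+ x ℤ.+ y ≡ 0ℤ
    comm≡0 = solve-∀

    w-resp : ∀ {s t} → s G.≈ t → w s ≋ w t
    w-resp (relᵈ aᵖ≡1)    = pow≋0 a
    w-resp (relᵈ bᵖ≡1)    = pow≋0 b
    w-resp (relᵈ cᵖ≡1)    = pow≋0 c
    w-resp (relᵈ [a,b]≡c) = ≡⇒≋ (comm≡0 α β)
    w-resp (relᵈ [c,a]≡1) = ≡⇒≋ (comm≡0 0ℤ α)
    w-resp (relᵈ [c,b]≡1) = ≡⇒≋ (comm≡0 0ℤ β)
    w-resp reflᵈ         = ≡⇒≋ ≡.refl
    w-resp (symᵈ d) with w-resp d
    ... | q , eq = ℤ.- q , ≡.trans (lem _ q (+ p))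
                     (≡.cong (ℤ._+ (ℤ.- q) ℤ.* + p) (≡.sym eq))
      where
      lem : ∀ y q m → y ≡ y ℤ.+ q ℤ.* m ℤ.+ (ℤ.- q) ℤ.* m
      lem = solve-∀
    w-resp (transᵈ {u = u} d d′) with w-resp d | w-resp d′
    ... | q , eq | q′ , eq′ = q′ ℤ.+ q , ≡.trans eq
            (≡.trans (≡.cong (ℤ._+ q ℤ.* + p) eq′) (lem (w u) q q′ (+ p)))
      where
      lem : ∀ y q q′ m → y ℤ.+ q′ ℤ.* m ℤ.+ q ℤ.* m ≡ y ℤ.+ (q′ ℤ.+ q) ℤ.* m
      lem = solve-∀
    w-resp (∙-congᵈ {s′ = s′} {t′ = t′} d d′) with w-resp d | w-resp d′
    ... | q , eq | q′ , eq′ = q ℤ.+ q′ , ≡.trans (≡.cong₂ ℤ._+_ eq eq′) (lem (w s′) (w t′) q q′ (+ p))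
      where
      lem : ∀ x y q q′ m → (x ℤ.+ q ℤ.* m) ℤ.+ (y ℤ.+ q′ ℤ.* m)
                         ≡ (x ℤ.+ y) ℤ.+ (q ℤ.+ q′) ℤ.* m
      lem = solve-∀
    w-resp (⁻¹-congᵈ {t = t} d) with w-resp d
    ... | q , eq = ℤ.- q , ≡.trans (≡.cong ℤ.-_ eq) (lem (w t) q (+ p))
      where
      lem : ∀ y q m → ℤ.- (y ℤ.+ q ℤ.* m) ≡ ℤ.- y ℤ.+ (ℤ.- q) ℤ.* m
      lem = solve-∀
    w-resp (assocᵈ s t u)  = ≡⇒≋ (ℤₚ.+-assoc (w s) (w t) (w u))
    w-resp (identityˡᵈ s)  = ≡⇒≋ (ℤₚ.+-identityˡ (w s))
    w-resp (identityʳᵈ s)  = ≡⇒≋ (ℤₚ.+-identityʳ (w s))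
    w-resp (inverseˡᵈ s)   = ≡⇒≋ (ℤₚ.+-inverseˡ (w s))
    w-resp (inverseʳᵈ s)   = ≡⇒≋ (ℤₚ.+-inverseʳ (w s))

  ≋0⇒∣ : ∀ n q → + n ≡ 0ℤ ℤ.+ q ℤ.* + p → p ℕ∣.∣ n
  ≋0⇒∣ n q eq = ℤ∣ₛ.∣⇒∣ᵤ {+ p} {+ n} (divides q (≡.trans eq (ℤₚ.+-identityˡ _)))

  ^≉ε : ∀ x → Weight.w 1ℤ 1ℤ x ≡ 1ℤ → ∀ i → 1 ≤ i → i ≤ p ∸ 1 → ¬ (1ᵗ G.≈ x ^ i)
  ^≉ε x wx i@(suc j) _ i≤ eq with W.w-resp (G.sym eq)
    where module W = Weight 1ℤ 1ℤ
  ... | q , eq′ = ℕₚ.<⇒≱ i<p (ℕ∣.∣⇒≤ (≋0⇒∣ i q (≡.trans (≡.sym wxⁱ) eq′)))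
    where
    module W = Weight 1ℤ 1ℤ
    wxⁱ : W.w (x ^ i) ≡ + i
    wxⁱ = ≡.trans (≡.cong W.w (^-agree x i)) (≡.trans (W.w-^ x i)
            (≡.trans (≡.cong (+ i ℤ.*_) wx) (ℤₚ.*-identityʳ (+ i))))
    i<p : i ℕ.< p
    i<p = lem p i≤
      where
      lem : ∀ m → suc j ≤ m ∸ 1 → suc j ℕ.< m
      lem (suc m) le = s≤s le

  ^-inv : ∀ x → x ^ p G.≈ 1ᵗ → ∀ i → i ≤ p → (x ^ i) ⁻¹ᵗ G.≈ x ^ (p ∸ i)
  ^-inv x xᵖ i i≤p = G.sym (inverseʳ-unique (x ^ i) (x ^ (p ∸ i))
    (G.trans (G.sym (×-homo-+ x i (p ∸ i)))
      (G.trans (G.reflexive (≡.cong (x ^_) (ℕₚ.m+[n∸m]≡n i≤p))) xᵖ)))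

  aᵖ : a ^ p G.≈ 1ᵗ
  aᵖ = G.trans (G.reflexive (^-agree a p)) (relᵈ aᵖ≡1)

  bᵖ : b ^ p G.≈ 1ᵗ
  bᵖ = G.trans (G.reflexive (^-agree b p)) (relᵈ bᵖ≡1)

  bounds : ∀ m i → 1 ≤ i → i ≤ m ∸ 1 → i ≤ m × 1 ≤ m ∸ i × m ∸ i ≤ m ∸ 1
  bounds zero    (suc i) _ ()
  bounds (suc m) i 1≤i i≤m =
    ℕₚ.m≤n⇒m≤1+n i≤m , ℕₚ.m<n⇒0<n∸m (s≤s i≤m) , ℕₚ.∸-monoʳ-≤ (suc m) 1≤i

  connS : ConnectionSet (G p) 0ℓ
  connS = record
    { S = S
    ; S-resp = λ { x≈y (i , l , u , inj₁ e) → i , l , u , inj₁ (G.trans (G.sym x≈y) e)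
                 ; x≈y (i , l , u , inj₂ e) → i , l , u , inj₂ (G.trans (G.sym x≈y) e) }
    ; ε∉S = λ { (i , l , u , inj₁ e) → ^≉ε a ≡.refl i l u e
              ; (i , l , u , inj₂ e) → ^≉ε b ≡.refl i l u e }
    ; S⁻¹⊆S = closed
    }
    where
    closed : ∀ {x} → S x → S (x ⁻¹ᵗ)
    closed (i , l , u , e) with bounds p i l u
    ... | i≤p , l′ , u′ = p ∸ i , l′ , u′ , Sum.map
      (λ e₁ → G.trans (G.⁻¹-cong e₁) (^-inv a aᵖ i i≤p))
      (λ e₂ → G.trans (G.⁻¹-cong e₂) (^-inv b bᵖ i i≤p)) e

  ⟨a⟩ ⟨b⟩ : Subgroup (G p) 0ℓ
  ⟨a⟩ = ⟨_⟩ (G p) a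
  ⟨b⟩ = ⟨_⟩ (G p) b

  private
    module _ where
      open Weight 0ℤ 1ℤ

      w≋0 : ∀ {y} → Generated (G p) a y → w y ≋ 0ℤ
      w≋0 base = ≡⇒≋ ≡.refl
      w≋0 unit = ≡⇒≋ ≡.refl
      w≋0 (prod d d′) with w≋0 d | w≋0 d′
      ... | q , eq | q′ , eq′ = q ℤ.+ q′ , ≡.trans (≡.cong₂ ℤ._+_ eq eq′) (lem q q′ (+ p))
        where
        lem : ∀ q q′ m → (0ℤ ℤ.+ q ℤ.* m) ℤ.+ (0ℤ ℤ.+ q′ ℤ.* m) ≡ 0ℤ ℤ.+ (q ℤ.+ q′) ℤ.* m
        lem = solve-∀
      w≋0 (inv d) with w≋0 d
      ... | q , eq = ℤ.- q , ≡.trans (≡.cong ℤ.-_ eq) (lem q (+ p))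
        where
        lem : ∀ q m → ℤ.- (0ℤ ℤ.+ q ℤ.* m) ≡ 0ℤ ℤ.+ (ℤ.- q) ℤ.* m
        lem = solve-∀
      w≋0 (≈-resp e d) with w-resp (G.sym e) | w≋0 d
      ... | q , eq | q′ , eq′ = q′ ℤ.+ q , ≡.trans eq
              (≡.trans (≡.cong (ℤ._+ q ℤ.* + p) eq′) (lem q q′ (+ p)))
        where
        lem : ∀ q q′ m → 0ℤ ℤ.+ q′ ℤ.* m ℤ.+ q ℤ.* m ≡ 0ℤ ℤ.+ (q′ ℤ.+ q) ℤ.* m
        lem = solve-∀

  ⟨a⟩≢⟨b⟩ : Prime p → ¬ (Subgroup.Mem ⟨a⟩ ≐ Subgroup.Mem ⟨b⟩)
  ⟨a⟩≢⟨b⟩ pr (_ , ⊇) with w≋0 (⊇ base)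
  ... | q , eq = ¬prime[1] (≡.subst Prime (ℕ∣.∣1⇒≡1 (≋0⇒∣ 1 q eq)) pr)

{-# OPTIONS --safe #-}
module Submission where

-- Since ⟨a⟩ ∩ ⟨b⟩ = 1, the edges of the coset graph are the flags (⟨a⟩g, ⟨b⟩g),
-- one for each g ∈ G, and two flags share an end exactly when the quotient of
-- their elements lies in ⟨a⟩ or in ⟨b⟩: this is the line graph statement.
--
-- Any 3-arc has the middle edge ⟨a⟩y, ⟨b⟩y for some y, in one of the two
-- orders, and its outer vertices are ⟨b⟩aⁱy and ⟨a⟩bʲy with i, j prime to p.
-- Hence it is the image of the arc ⟨b⟩a, ⟨a⟩, ⟨b⟩, ⟨a⟩b under right translation
-- by y, the automorphism a ↦ aⁱ, b ↦ bʲ of G and, to reverse the order, the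
-- automorphism exchanging a and b.  All of these act on the coset graph.

open import Defs
open import Data.Nat.Base using (ℕ)
open import Data.Nat.Divisibility using (_∣_)
open import Data.Nat.Primality using (Prime)
open import Data.Product.Base using (_×_)
open import Relation.Nullary.Negation using (¬_)

open import Level using (Level; 0ℓ)
open import Algebra.Bundles using (Group)
import Algebra.Properties.Group as GroupProperties
import Algebra.Properties.Monoid.Mult as MonoidMult
open import Data.Empty using (⊥-elim)
open import Data.Fin.Base using (Fin; zero; suc; toℕ)
open import Data.Integer.Base as ℤ using (+_; 0ℤ; 1ℤ)
import Data.Integer.Properties as ℤₚ
import Data.Nat.Base as ℕ
open import Data.Nat.Base using (suc; zero; _<_; _∸_; NonZero)
open import Data.Nat.Coprimality using (prime⇒coprime; coprime-Bézout)
import Data.Nat.Divisibility as ℕ∣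
open import Data.Nat.DivMod using (_%_; _/_; m%n<n; m≡m%n+[m/n]*n)
open import Data.Nat.GCD using (module Bézout)
open import Data.Nat.Primality using (prime⇒nonZero; prime⇒nonTrivial)
import Data.Nat.Properties as ℕₚ
open import Data.Nat.Tactic.RingSolver using (solve-∀)
open import Data.Product.Base using (∃-syntax; Σ-syntax; _,_; proj₁; proj₂)
open import Data.Sum.Base using (_⊎_; inj₁; inj₂; [_,_]′)
open import Function.Base using (_∘_)
open import Function.Bundles using (Inverse; Equivalence; mk⇔)
import Function.Construct.Composition as Composition
import Function.Construct.Symmetry as Symmetry
open import Relation.Binary.Bundles using (Setoid)
open import Relation.Binary.Core using (Rel)
open import Relation.Binary.PropositionalEquality as ≡ using (_≡_)
import Relation.Binary.Reasoning.Setoid as SetoidReasoning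
open import Relation.Unary using (_∈_; _≐_)

private variable
  o ℓ e o′ ℓ′ e′ o″ ℓ″ e″ h : Level

-- Graph isomorphisms and arc-transitivity from one base arc.

module _ {Γ : Graph o ℓ e} {Δ : Graph o′ ℓ′ e′} where
  private
    module Γ = Graph Γ
    module Δ = Graph Δ

  ≅-sym : Γ ≅ Δ → Δ ≅ Γ
  ≅-sym φ = record
    { bijection = Symmetry.inverse bijection
    ; adj⇔ = λ u v → mk⇔
        (λ uv → Equivalence.from (adj⇔ (from u) (from v))
          (proj₁ Δ.resp (Δ.≈-sym (Inverse.strictlyInverseˡ bijection v))
            (proj₂ Δ.resp (Δ.≈-sym (Inverse.strictlyInverseˡ bijection u)) uv)))
        (λ uv → proj₁ Δ.resp (Inverse.strictlyInverseˡ bijection v)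
          (proj₂ Δ.resp (Inverse.strictlyInverseˡ bijection u)
            (Equivalence.to (adj⇔ (from u) (from v)) uv)))
    }
    where open _≅_ φ

≅-trans : {Γ : Graph o ℓ e} {Δ : Graph o′ ℓ′ e′} {Θ : Graph o″ ℓ″ e″} →
          Γ ≅ Δ → Δ ≅ Θ → Γ ≅ Θ
≅-trans φ ψ = record
  { bijection = Composition.inverse φ.bijection ψ.bijection
  ; adj⇔ = λ u v → Composition.equivalence (φ.adj⇔ u v) (ψ.adj⇔ (φ.to u) (φ.to v))
  }
  where
  module φ = _≅_ φ
  module ψ = _≅_ ψ

module _ {Γ : Graph o ℓ e} where
  open Graph Γ

  path₃ : ∀ u v w x → Adj u v → Adj v w → Adj w x → u ≉ w → v ≉ x → Arc Γ 3
  path₃ u v w x uv vw wx u≉w v≉x = record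
    { at = at ; consecutive = consecutive ; noBacktrack = noBacktrack }
    where
    at : Fin 4 → Vertex
    at zero = u
    at (suc zero) = v
    at (suc (suc zero)) = w
    at (suc (suc (suc zero))) = x

    consecutive : ∀ i j → toℕ j ≡ 1 ℕ.+ toℕ i → Adj (at i) (at j)
    consecutive zero (suc zero) ≡.refl = uv
    consecutive (suc zero) (suc (suc zero)) ≡.refl = vw
    consecutive (suc (suc zero)) (suc (suc (suc zero))) ≡.refl = wx
    consecutive (suc (suc (suc zero))) (suc (suc (suc (suc ())))) _

    noBacktrack : ∀ i j → toℕ j ≡ 2 ℕ.+ toℕ i → at i ≉ at j
    noBacktrack zero (suc (suc zero)) ≡.refl = u≉w
    noBacktrack (suc zero) (suc (suc (suc zero))) ≡.refl = v≉x
    noBacktrack (suc (suc zero)) (suc (suc (suc (suc ())))) _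

  -- Both arcs are images of `α₀`: undoing the automorphism that reaches `α` and then applying the
  -- one that reaches `β` takes `α` to `β`.
  arcTransitive-from : ∀ {s} (α₀ : Arc Γ s) →
    (∀ β → Σ[ φ ∈ Aut Γ ] (∀ i → _≅_.to φ (Arc.at α₀ i) ≈ Arc.at β i)) →
    ArcTransitive Γ s
  arcTransitive-from α₀ reach = record
    { arc = α₀
    ; transitive = λ α β →
        let φ , φ-at = reach α
            ψ , ψ-at = reach β
            module φ = _≅_ φ
            module ψ = _≅_ ψ
        in ≅-trans (≅-sym φ) ψ , λ i → ≈-trans
             (Inverse.to-cong ψ.bijection
               (≈-trans (Inverse.from-cong φ.bijection (≈-sym (φ-at i)))
                        (Inverse.strictlyInverseʳ φ.bijection (Arc.at α₀ i))))
             (ψ-at i)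
    }

-- Powers and commutators in an arbitrary group.

module PowersAndCommutators (G : Group o ℓ) where
  open Group G
  open GroupProperties G
  open RawGroupOps rawGroup
  open MonoidMult monoid using (×-congʳ; ×-assocˡ; ×-homo-+)
  open SetoidReasoning setoid

  ε^n≈ε : ∀ n → ε ^ n ≈ ε
  ε^n≈ε zero    = refl
  ε^n≈ε (suc n) = trans (identityˡ _) (ε^n≈ε n)

  x^n≈ε⇒x^mn≈ε : ∀ {x n} → x ^ n ≈ ε → ∀ m → x ^ (m ℕ.* n) ≈ ε
  x^n≈ε⇒x^mn≈ε {x} {n} xⁿ m = begin
    x ^ (m ℕ.* n) ≈⟨ ×-assocˡ x m n ⟨
    (x ^ n) ^ m   ≈⟨ ×-congʳ m xⁿ ⟩
    ε ^ m         ≈⟨ ε^n≈ε m ⟩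
    ε             ∎

  x^n≈ε⇒[x^m]^n≈ε : ∀ {x n} → x ^ n ≈ ε → ∀ m → (x ^ m) ^ n ≈ ε
  x^n≈ε⇒[x^m]^n≈ε {x} {n} xⁿ m = begin
    (x ^ m) ^ n   ≈⟨ ×-assocˡ x n m ⟩
    x ^ (n ℕ.* m) ≡⟨ ≡.cong (x ^_) (ℕₚ.*-comm n m) ⟩
    x ^ (m ℕ.* n) ≈⟨ x^n≈ε⇒x^mn≈ε xⁿ m ⟩
    ε             ∎

  -- The equation on exponents is `k i ≡ 1` modulo `n`, with a multiple of `n` on each side so as to
  -- stay within the natural numbers. This makes the dilations of the Heisenberg group invertible.
  x^n≈ε⇒[x^i]^k≈x : ∀ {x n l m} → x ^ n ≈ ε → ∀ k i →
                    k ℕ.* i ℕ.+ l ℕ.* n ≡ 1 ℕ.+ m ℕ.* n → (x ^ i) ^ k ≈ x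
  x^n≈ε⇒[x^i]^k≈x {x} {n} {l} {m} xⁿ k i eq = begin
    (x ^ i) ^ k                     ≈⟨ ×-assocˡ x k i ⟩
    x ^ (k ℕ.* i)                   ≈⟨ identityʳ _ ⟨
    x ^ (k ℕ.* i) ∙ ε               ≈⟨ ∙-congˡ (x^n≈ε⇒x^mn≈ε xⁿ l) ⟨
    x ^ (k ℕ.* i) ∙ x ^ (l ℕ.* n)   ≈⟨ ×-homo-+ x (k ℕ.* i) _ ⟨
    x ^ (k ℕ.* i ℕ.+ l ℕ.* n)       ≡⟨ ≡.cong (x ^_) eq ⟩
    x ∙ x ^ (m ℕ.* n)               ≈⟨ ∙-congˡ (x^n≈ε⇒x^mn≈ε xⁿ m) ⟩
    x ∙ ε                           ≈⟨ identityʳ x ⟩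
    x                               ∎

  ^-mod : ∀ {x n} .{{_ : NonZero n}} → x ^ n ≈ ε → ∀ m → x ^ m ≈ x ^ (m % n)
  ^-mod {x} {n} xⁿ m = begin
    x ^ m                                   ≡⟨ ≡.cong (x ^_) (m≡m%n+[m/n]*n m n) ⟩
    x ^ (m % n ℕ.+ (m / n) ℕ.* n)           ≈⟨ ×-homo-+ x (m % n) _ ⟩
    x ^ (m % n) ∙ x ^ ((m / n) ℕ.* n)       ≈⟨ ∙-congˡ (x^n≈ε⇒x^mn≈ε xⁿ (m / n)) ⟩
    x ^ (m % n) ∙ ε                         ≈⟨ identityʳ _ ⟩
    x ^ (m % n)                             ∎

  commutator-quotient : ∀ x y → [ x , y ] ≈ (y ∙ x) ⁻¹ ∙ (x ∙ y)
  commutator-quotient x y = begin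
    x ⁻¹ ∙ y ⁻¹ ∙ x ∙ y     ≈⟨ assoc _ x y ⟩
    x ⁻¹ ∙ y ⁻¹ ∙ (x ∙ y)   ≈⟨ ∙-congʳ (⁻¹-anti-homo-∙ y x) ⟨
    (y ∙ x) ⁻¹ ∙ (x ∙ y)    ∎

  commutator⇒ : ∀ {x y z} → [ x , y ] ≈ z → x ∙ y ≈ y ∙ x ∙ z
  commutator⇒ {x} {y} {z} eq = begin
    x ∙ y                             ≈⟨ \\-leftDividesˡ (y ∙ x) (x ∙ y) ⟨
    y ∙ x ∙ ((y ∙ x) ⁻¹ ∙ (x ∙ y))    ≈⟨ ∙-congˡ (commutator-quotient x y) ⟨
    y ∙ x ∙ [ x , y ]                 ≈⟨ ∙-congˡ eq ⟩
    y ∙ x ∙ z                         ∎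

  commutator⇐ : ∀ {x y z} → x ∙ y ≈ y ∙ x ∙ z → [ x , y ] ≈ z
  commutator⇐ {x} {y} {z} eq = begin
    [ x , y ]                        ≈⟨ commutator-quotient x y ⟩
    (y ∙ x) ⁻¹ ∙ (x ∙ y)             ≈⟨ ∙-congˡ eq ⟩
    (y ∙ x) ⁻¹ ∙ (y ∙ x ∙ z)         ≈⟨ \\-leftDividesʳ (y ∙ x) z ⟩
    z                                ∎

  commuting⇒ : ∀ {x y} → [ x , y ] ≈ ε → x ∙ y ≈ y ∙ x
  commuting⇒ eq = trans (commutator⇒ eq) (identityʳ _)

  commuting⇐ : ∀ {x y} → x ∙ y ≈ y ∙ x → [ x , y ] ≈ ε
  commuting⇐ eq = commutator⇐ (trans eq (sym (identityʳ _)))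

  commuting-^ : ∀ {x y} → x ∙ y ≈ y ∙ x → ∀ n → x ^ n ∙ y ≈ y ∙ x ^ n
  commuting-^ xy zero = trans (identityˡ _) (sym (identityʳ _))
  commuting-^ {x} {y} xy (suc n) = begin
    x ∙ x ^ n ∙ y     ≈⟨ assoc x _ y ⟩
    x ∙ (x ^ n ∙ y)   ≈⟨ ∙-congˡ (commuting-^ xy n) ⟩
    x ∙ (y ∙ x ^ n)   ≈⟨ assoc x y _ ⟨
    x ∙ y ∙ x ^ n     ≈⟨ ∙-congʳ xy ⟩
    y ∙ x ∙ x ^ n     ≈⟨ assoc y x _ ⟩
    y ∙ (x ∙ x ^ n)   ∎

  commuting-⁻¹ : ∀ {x y} → x ∙ y ≈ y ∙ x → x ⁻¹ ∙ y ≈ y ∙ x ⁻¹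
  commuting-⁻¹ {x} {y} xy = begin
    x ⁻¹ ∙ y                   ≈⟨ //-rightDividesʳ x _ ⟨
    x ⁻¹ ∙ y ∙ x ∙ x ⁻¹        ≈⟨ ∙-congʳ (assoc _ y x) ⟩
    x ⁻¹ ∙ (y ∙ x) ∙ x ⁻¹      ≈⟨ ∙-congʳ (∙-congˡ xy) ⟨
    x ⁻¹ ∙ (x ∙ y) ∙ x ⁻¹      ≈⟨ ∙-congʳ (\\-leftDividesʳ x y) ⟩
    y ∙ x ⁻¹                   ∎

  -- Moving `y` to the left past one factor `x` leaves one `z`. As `z` commutes with `x`, the `n`
  -- copies of `z` collect on the right.
  commutator-^ : ∀ {x y z} → [ x , y ] ≈ z → z ∙ x ≈ x ∙ z → ∀ n → [ x ^ n , y ] ≈ z ^ n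
  commutator-^ {x} {y} {z} xy zx n = commutator⇐ (shift n)
    where
    shift : ∀ n → x ^ n ∙ y ≈ y ∙ x ^ n ∙ z ^ n
    shift zero = trans (identityˡ y) (trans (sym (identityʳ y)) (sym (identityʳ _)))
    shift (suc n) = begin
      x ∙ x ^ n ∙ y                 ≈⟨ assoc x _ y ⟩
      x ∙ (x ^ n ∙ y)               ≈⟨ ∙-congˡ (trans (shift n) (assoc y _ _)) ⟩
      x ∙ (y ∙ (x ^ n ∙ z ^ n))     ≈⟨ assoc x y _ ⟨
      x ∙ y ∙ (x ^ n ∙ z ^ n)       ≈⟨ ∙-congʳ (commutator⇒ xy) ⟩
      y ∙ x ∙ z ∙ (x ^ n ∙ z ^ n)   ≈⟨ trans (assoc _ _ _) (∙-congˡ (sym (assoc _ _ _))) ⟩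
      y ∙ x ∙ (z ∙ x ^ n ∙ z ^ n)   ≈⟨ ∙-congˡ (∙-congʳ (commuting-^ (sym zx) n)) ⟨
      y ∙ x ∙ (x ^ n ∙ z ∙ z ^ n)   ≈⟨ ∙-congˡ (assoc _ _ _) ⟩
      y ∙ x ∙ (x ^ n ∙ (z ∙ z ^ n)) ≈⟨ trans (sym (assoc _ _ _)) (∙-congʳ (assoc _ _ _)) ⟩
      y ∙ (x ∙ x ^ n) ∙ (z ∙ z ^ n) ∎

  commutator-swap : ∀ {x y z} → [ x , y ] ≈ z → [ y , x ] ≈ z ⁻¹
  commutator-swap {x} {y} {z} eq = commutator⇐ (begin
    y ∙ x             ≈⟨ //-rightDividesʳ z _ ⟨
    y ∙ x ∙ z ∙ z ⁻¹  ≈⟨ ∙-congʳ (commutator⇒ eq) ⟨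
    x ∙ y ∙ z ⁻¹      ∎)

  -- Powers of `x ⁻¹` commute with `x`, so `(x ⁻¹) ^ n ∙ x ^ n` cancels one pair at a time. The
  -- relator `c ^ p` calls for this when `c` goes to `c ⁻¹`.
  x^n≈ε⇒[x⁻¹]^n≈ε : ∀ {x} n → x ^ n ≈ ε → (x ⁻¹) ^ n ≈ ε
  x^n≈ε⇒[x⁻¹]^n≈ε {x} n xⁿ = begin
    (x ⁻¹) ^ n           ≈⟨ identityʳ _ ⟨
    (x ⁻¹) ^ n ∙ ε       ≈⟨ ∙-congˡ xⁿ ⟨
    (x ⁻¹) ^ n ∙ x ^ n   ≈⟨ cancel n ⟩
    ε                  ∎
    where
    cancel : ∀ n → (x ⁻¹) ^ n ∙ x ^ n ≈ ε
    cancel zero = identityˡ ε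
    cancel (suc n) = begin
      x ⁻¹ ∙ (x ⁻¹) ^ n ∙ (x ∙ x ^ n)      ≈⟨ assoc _ _ _ ⟩
      x ⁻¹ ∙ ((x ⁻¹) ^ n ∙ (x ∙ x ^ n))    ≈⟨ ∙-congˡ (assoc _ _ _) ⟨
      x ⁻¹ ∙ ((x ⁻¹) ^ n ∙ x ∙ x ^ n)      ≈⟨ ∙-congˡ (∙-congʳ (commuting-^ (trans (inverseˡ x) (sym (inverseʳ x))) n)) ⟩
      x ⁻¹ ∙ (x ∙ (x ⁻¹) ^ n ∙ x ^ n)      ≈⟨ ∙-congˡ (assoc _ _ _) ⟩
      x ⁻¹ ∙ (x ∙ ((x ⁻¹) ^ n ∙ x ^ n))    ≈⟨ \\-leftDividesʳ x _ ⟩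
      (x ⁻¹) ^ n ∙ x ^ n                   ≈⟨ cancel n ⟩
      ε                                  ∎

-- Right cosets of a subgroup.

module _ (G : Group o ℓ) (H : Subgroup G h) where
  open Group G
  open GroupProperties G
  open Subgroup H

  private
    infix 6 H·_
    H·_ : Carrier → Carrier → Set _
    H·_ = _·_ G H

  ∈-coset-self : ∀ g → g ∈ H· g
  ∈-coset-self g = ε , ε-mem , sym (identityˡ g)

  ∈-coset-resp : ∀ {g x y} → x ≈ y → x ∈ H· g → y ∈ H· g
  ∈-coset-resp x≈y (m , m∈H , x≈mg) = m , m∈H , trans (sym x≈y) x≈mg

  ∈-coset⇒≐ : ∀ {g x} → x ∈ H· g → H· x ≐ H· g
  ∈-coset⇒≐ {g} {x} (m , m∈H , x≈mg) =
      (λ (n , n∈H , y≈nx) → n ∙ m , ∙-mem n∈H m∈H ,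
        trans y≈nx (trans (∙-congˡ x≈mg) (sym (assoc n m g))))
    , (λ (n , n∈H , y≈ng) → n ∙ m ⁻¹ , ∙-mem n∈H (⁻¹-mem m∈H) ,
        trans y≈ng (trans (∙-congˡ g≈m⁻¹x) (sym (assoc n (m ⁻¹) x))))
    where
    g≈m⁻¹x : g ≈ m ⁻¹ ∙ x
    g≈m⁻¹x = trans (sym (\\-leftDividesʳ m g)) (∙-congˡ (sym x≈mg))

  same-coset⇒quotient : ∀ {g x y} → x ∈ H· g → y ∈ H· g → (x ∙ y ⁻¹) ∈ Mem
  same-coset⇒quotient {g} {x} {y} (m , m∈H , x≈mg) (n , n∈H , y≈ng) =
    Mem-resp (sym xy⁻¹≈mn⁻¹) (∙-mem m∈H (⁻¹-mem n∈H))
    where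
    open SetoidReasoning setoid
    xy⁻¹≈mn⁻¹ : x ∙ y ⁻¹ ≈ m ∙ n ⁻¹
    xy⁻¹≈mn⁻¹ = begin
      x ∙ y ⁻¹                 ≈⟨ ∙-cong x≈mg (⁻¹-cong y≈ng) ⟩
      m ∙ g ∙ (n ∙ g) ⁻¹       ≈⟨ ∙-congˡ (⁻¹-anti-homo-∙ n g) ⟩
      m ∙ g ∙ (g ⁻¹ ∙ n ⁻¹)    ≈⟨ assoc _ _ _ ⟨
      m ∙ g ∙ g ⁻¹ ∙ n ⁻¹      ≈⟨ ∙-congʳ (//-rightDividesʳ g m) ⟩
      m ∙ n ⁻¹                 ∎

  quotient⇒∈-coset : ∀ {x y} → (x ∙ y ⁻¹) ∈ Mem → x ∈ H· y
  quotient⇒∈-coset {x} {y} xy⁻¹∈H = x ∙ y ⁻¹ , xy⁻¹∈H , sym (//-rightDividesˡ y x)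

-- The coset graph of two subgroups and its symmetries.

data Orientation : Set where
  keep flip : Orientation

module CosetGraph (G : Group o ℓ) (H K : Subgroup G h)
                  (H≢K : ¬ (Subgroup.Mem H ≐ Subgroup.Mem K)) where
  open Group G
  open GroupProperties G using (//-rightDividesʳ; //-rightDividesˡ)

  Σ : Graph _ _ _
  Σ = Cos G H K H≢K

  open Graph Σ public using (Adj; resp; symm; ≈-refl; ≈-sym; ≈-trans)

  CosetOf : Coset G H K → Carrier → Set _
  CosetOf = ⟦_⟧ G H K

  infix 4 _≋_ _≋̸_
  _≋_ _≋̸_ : Rel (Coset G H K) _
  _≋_ = _≈ᶜ_ G H K
  u ≋̸ v = ¬ (u ≋ v)

  ≋-refl : ∀ u → u ≋ u
  ≋-refl u = ≈-refl {u}

  ≋-trans : ∀ u v w → u ≋ v → v ≋ w → u ≋ w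
  ≋-trans u v w = ≈-trans {u} {v} {w}

  CosetOf-resp : ∀ u {x y} → x ≈ y → x ∈ CosetOf u → y ∈ CosetOf u
  CosetOf-resp (left g)  = ∈-coset-resp G H
  CosetOf-resp (right g) = ∈-coset-resp G K

  ∈left⇒≋ : ∀ {g x} → x ∈ CosetOf (left g) → left x ≋ left g
  ∈left⇒≋ = ∈-coset⇒≐ G H

  ∈right⇒≋ : ∀ {g x} → x ∈ CosetOf (right g) → right x ≋ right g
  ∈right⇒≋ = ∈-coset⇒≐ G K

  same-left : ∀ {x g k} → x ∈ CosetOf (left g) → x ∈ CosetOf (left k) → left g ≋ left k
  same-left {x} {g} {k} x∈g x∈k =
    ≋-trans (left g) (left x) (left k) (≈-sym {left x} {left g} (∈left⇒≋ x∈g)) (∈left⇒≋ x∈k)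

  same-right : ∀ {x g k} → x ∈ CosetOf (right g) → x ∈ CosetOf (right k) → right g ≋ right k
  same-right {x} {g} {k} x∈g x∈k =
    ≋-trans (right g) (right x) (right k) (≈-sym {right x} {right g} (∈right⇒≋ x∈g)) (∈right⇒≋ x∈k)

  left-of : ∀ {g x y} → x ≈ y → y ∈ CosetOf (left g) → left x ≋ left g
  left-of x≈y y∈g = ∈left⇒≋ (∈-coset-resp G H (sym x≈y) y∈g)

  right-of : ∀ {g x y} → x ≈ y → y ∈ CosetOf (right g) → right x ≋ right g
  right-of x≈y y∈g = ∈right⇒≋ (∈-coset-resp G K (sym x≈y) y∈g)

  left-cong : ∀ {x y} → x ≈ y → left x ≋ left y
  left-cong {y = y} x≈y = left-of {y} x≈y (∈-coset-self G H y)

  right-cong : ∀ {x y} → x ≈ y → right x ≋ right y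
  right-cong {y = y} x≈y = right-of {y} x≈y (∈-coset-self G K y)

  left≋̸right : ∀ {g k} → left g ≋̸ right k
  left≋̸right {g} {k} = H≢K ∘ left≈right⇒H≐K G H K {g} {k}

  adj-left-right : ∀ {g k x} → x ∈ CosetOf (left g) → x ∈ CosetOf (right k) → Adj (left g) (right k)
  adj-left-right {g} {k} {x} x∈g x∈k = (g , k , inj₁ (≋-refl (left g) , ≋-refl (right k))) , x , x∈g , x∈k

  -- Adjacency makes one of the ends equal, as a set, to a coset of `K`. A coset of `H` is never
  -- one, since a coset determines its subgroup.
  ¬adj-left-left : ∀ {g k} → ¬ Adj (left g) (left k)
  ¬adj-left-left {g} {k} ((_ , l , inj₁ (_ , e)) , _) = left≋̸right {k} {l} e
  ¬adj-left-left {g} {k} ((_ , l , inj₂ (e , _)) , _) = left≋̸right {g} {l} e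

  ¬adj-right-right : ∀ {g k} → ¬ Adj (right g) (right k)
  ¬adj-right-right {g} {k} ((l , _ , inj₁ (e , _)) , _) = left≋̸right {l} {g} (≈-sym {right g} {left l} e)
  ¬adj-right-right {g} {k} ((l , _ , inj₂ (_ , e)) , _) = left≋̸right {l} {k} (≈-sym {right k} {left l} e)

  relabel : Orientation → (Carrier → Carrier) → Coset G H K → Coset G H K
  relabel keep f (left g)  = left (f g)
  relabel keep f (right g) = right (f g)
  relabel flip f (left g)  = right (f g)
  relabel flip f (right g) = left (f g)

  -- A permutation of G carrying the cosets of H and K to cosets, either
  -- respecting the two families or exchanging them.
  record CosetSymmetry (d : Orientation) : Set (o Level.⊔ ℓ Level.⊔ h) where
    field
      to from : Carrier → Carrier
      to-cong   : ∀ {x y} → x ≈ y → to x ≈ to y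
      from-cong : ∀ {x y} → x ≈ y → from x ≈ from y
      to∘from   : ∀ x → to (from x) ≈ x
      from∘to   : ∀ x → from (to x) ≈ x
      to-mem    : ∀ u {x} → x ∈ CosetOf u → to x ∈ CosetOf (relabel d to u)
      from-mem  : ∀ u {x} → x ∈ CosetOf u → from x ∈ CosetOf (relabel d from u)

  reverse : ∀ {d} → CosetSymmetry d → CosetSymmetry d
  reverse f = record
    { to = from ; from = to ; to-cong = from-cong ; from-cong = to-cong
    ; to∘from = from∘to ; from∘to = to∘from ; to-mem = from-mem ; from-mem = to-mem }
    where open CosetSymmetry f

  image : ∀ {d} → CosetSymmetry d → Coset G H K → Coset G H K
  image {d} f = relabel d (CosetSymmetry.to f)

  private
    image-reverse : ∀ {d} (f : CosetSymmetry d) u → image (reverse f) (image f u) ≋ u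
    image-reverse {keep} f (left g)  = left-cong (CosetSymmetry.from∘to f g)
    image-reverse {keep} f (right g) = right-cong (CosetSymmetry.from∘to f g)
    image-reverse {flip} f (left g)  = left-cong (CosetSymmetry.from∘to f g)
    image-reverse {flip} f (right g) = right-cong (CosetSymmetry.from∘to f g)

    -- A point of the image of `u` is pulled back to `u` by `from`, lies in `v` by the inclusion,
    -- and is pushed forward again by `to`. Hence `image f` is well defined on cosets as sets.
    image-⊆ : ∀ {d} (f : CosetSymmetry d) u v →
              (∀ {x} → x ∈ CosetOf u → x ∈ CosetOf v) →
              ∀ {x} → x ∈ CosetOf (image f u) → x ∈ CosetOf (image f v)
    image-⊆ f u v u⊆v {x} x∈fu = CosetOf-resp (image f v) (to∘from x)
      (to-mem v (u⊆v (proj₁ (image-reverse f u) (from-mem (image f u) x∈fu))))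
      where open CosetSymmetry f

    image-cong : ∀ {d} (f : CosetSymmetry d) {u v} → u ≋ v → image f u ≋ image f v
    image-cong f {u} {v} (u⊆v , v⊆u) = image-⊆ f u v u⊆v , image-⊆ f v u v⊆u

    image-adj : ∀ {d} (f : CosetSymmetry d) {u v} → Adj u v → Adj (image f u) (image f v)
    image-adj {d} f {u} {v} (sides , x , x∈u , x∈v) =
      sides-image d f sides , CosetSymmetry.to f x , CosetSymmetry.to-mem f u x∈u , CosetSymmetry.to-mem f v x∈v
      where
      sides-image : ∀ d (f : CosetSymmetry d) →
             ∃[ g ] ∃[ k ] (u ≋ left g × v ≋ right k ⊎ u ≋ right k × v ≋ left g) →
             ∃[ g ] ∃[ k ] (image f u ≋ left g × image f v ≋ right k
                          ⊎ image f u ≋ right k × image f v ≋ left g)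
      sides-image keep f (g , k , inj₁ (p , q)) = _ , _ , inj₁ (image-cong f {u} {left g} p , image-cong f {v} {right k} q)
      sides-image keep f (g , k , inj₂ (p , q)) = _ , _ , inj₂ (image-cong f {u} {right k} p , image-cong f {v} {left g} q)
      -- Under `flip` the alternatives change places, because cosets of `H` become cosets of `K`.
      sides-image flip f (g , k , inj₁ (p , q)) = _ , _ , inj₂ (image-cong f {u} {left g} p , image-cong f {v} {right k} q)
      sides-image flip f (g , k , inj₂ (p , q)) = _ , _ , inj₁ (image-cong f {u} {right k} p , image-cong f {v} {left g} q)

  automorphism : ∀ {d} → CosetSymmetry d → Aut Σ
  automorphism f = record
    { bijection = record
      { to = image f
      ; from = image (reverse f)
      ; to-cong = λ {u} {v} → image-cong f {u} {v}
      ; from-cong = λ {u} {v} → image-cong (reverse f) {u} {v}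
      ; inverse =
          (λ {v} {u} e → ≋-trans (image f u) (image f (image (reverse f) v)) v
            (image-cong f {u} {image (reverse f) v} e)
            (image-reverse (reverse f) v))
        , (λ {u} {v} e → ≋-trans (image (reverse f) v) (image (reverse f) (image f u)) u
            (image-cong (reverse f) {v} {image f u} e)
            (image-reverse f u))
      }
    -- Adjacency is reflected because the reverse symmetry preserves it and undoes `image f`.
    ; adj⇔ = λ u v → mk⇔ (image-adj f {u} {v}) (λ fu~fv →
        proj₁ resp {u} {image (reverse f) (image f v)} {v} (image-reverse f v)
          (proj₂ resp {image (reverse f) (image f v)} {image (reverse f) (image f u)} {u} (image-reverse f u)
            (image-adj (reverse f) {image f u} {image f v} fu~fv)))
    }

  translation : Carrier → CosetSymmetry keep
  translation y = record
    { to = _∙ y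
    ; from = _∙ y ⁻¹
    ; to-cong = ∙-congʳ
    ; from-cong = ∙-congʳ
    ; to∘from = λ x → //-rightDividesˡ y x
    ; from∘to = λ x → //-rightDividesʳ y x
    ; to-mem = mem y
    ; from-mem = mem (y ⁻¹)
    }
    where
    mem : ∀ y u {x} → x ∈ CosetOf u → x ∙ y ∈ CosetOf (relabel keep (_∙ y) u)
    mem y (left g)  (m , m∈H , x≈mg) = m , m∈H , trans (∙-congʳ x≈mg) (assoc m g y)
    mem y (right g) (m , m∈K , x≈mg) = m , m∈K , trans (∙-congʳ x≈mg) (assoc m g y)

  -- A homomorphism `φ` sends `m ∙ g` to `φ m ∙ φ g`, so these are the subgroups into which `H` and
  -- `K` must go for `relabel d φ` to describe the images of cosets.
  leftImage rightImage : Orientation → Subgroup G h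
  leftImage keep = H
  leftImage flip = K
  rightImage keep = K
  rightImage flip = H

  homomorphism-mem : ∀ d {φ : Carrier → Carrier} →
    (∀ {x y} → x ≈ y → φ x ≈ φ y) → (∀ x y → φ (x ∙ y) ≈ φ x ∙ φ y) →
    (∀ {x} → x ∈ Subgroup.Mem H → φ x ∈ Subgroup.Mem (leftImage d)) →
    (∀ {x} → x ∈ Subgroup.Mem K → φ x ∈ Subgroup.Mem (rightImage d)) →
    ∀ u {x} → x ∈ CosetOf u → φ x ∈ CosetOf (relabel d φ u)
  homomorphism-mem keep cong hom φH φK (left g)  (m , m∈ , e) = _ , φH m∈ , trans (cong e) (hom m g)
  homomorphism-mem keep cong hom φH φK (right g) (m , m∈ , e) = _ , φK m∈ , trans (cong e) (hom m g)
  homomorphism-mem flip cong hom φH φK (left g)  (m , m∈ , e) = _ , φH m∈ , trans (cong e) (hom m g)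
  homomorphism-mem flip cong hom φH φK (right g) (m , m∈ , e) = _ , φK m∈ , trans (cong e) (hom m g)

  -- The line graph when `H` and `K` meet trivially.

  module _ (H∩K : ∀ {x} → x ∈ Subgroup.Mem H → x ∈ Subgroup.Mem K → x ≈ ε) where
    open GroupProperties G using (x∙y⁻¹≈ε⇒x≈y; x≈y⇒x∙y⁻¹≈ε)

    private
      Line : Graph _ _ _
      Line = LineGraph Σ

      infix 4 _≋ᵉ_
      _≋ᵉ_ : Rel (Edge Σ) _
      _≋ᵉ_ = _≈ᵉ_ Σ

    left∩right-unique : ∀ {g k x y} → x ∈ CosetOf (left g) → x ∈ CosetOf (right k) →
                        y ∈ CosetOf (left g) → y ∈ CosetOf (right k) → x ≈ y
    left∩right-unique x∈g x∈k y∈g y∈k = x∙y⁻¹≈ε⇒x≈y _ _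
      (H∩K (same-coset⇒quotient G H x∈g y∈g) (same-coset⇒quotient G K x∈k y∈k))

    -- The quotient of two common elements lies in both `H` and `K`. So the witness stored in an
    -- adjacency depends only on the edge, and `intersection` is well defined.
    intersection-unique : ∀ {u v x y} → Adj u v → x ∈ CosetOf u → x ∈ CosetOf v →
                          y ∈ CosetOf u → y ∈ CosetOf v → x ≈ y
    intersection-unique ((_ , _ , inj₁ ((u⊆ , _) , (v⊆ , _))) , _) x∈u x∈v y∈u y∈v =
      left∩right-unique (u⊆ x∈u) (v⊆ x∈v) (u⊆ y∈u) (v⊆ y∈v)
    intersection-unique ((_ , _ , inj₂ ((u⊆ , _) , (v⊆ , _))) , _) x∈u x∈v y∈u y∈v =
      left∩right-unique (v⊆ x∈v) (u⊆ x∈u) (v⊆ y∈v) (u⊆ y∈u)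

    flag : Carrier → Edge Σ
    flag g = left g , right g , adj-left-right (∈-coset-self G H g) (∈-coset-self G K g)

    intersection : Edge Σ → Carrier
    intersection (_ , _ , _ , x , _) = x

    flag-cong : ∀ {g k} → g ≈ k → flag g ≋ᵉ flag k
    flag-cong g≈k = inj₁ (left-cong g≈k , right-cong g≈k)

    intersection-cong : ∀ e f → e ≋ᵉ f → intersection e ≈ intersection f
    intersection-cong (u , v , uv@(_ , x , x∈u , x∈v)) (_ , _ , _ , y , y∈ , y∈′) (inj₁ ((_ , ⊇u) , (_ , ⊇v))) =
      intersection-unique {u} {v} uv x∈u x∈v (⊇u y∈) (⊇v y∈′)
    intersection-cong (u , v , uv@(_ , x , x∈u , x∈v)) (_ , _ , _ , y , y∈ , y∈′) (inj₂ ((_ , ⊇u) , (_ , ⊇v))) =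
      intersection-unique {u} {v} uv x∈u x∈v (⊇u y∈′) (⊇v y∈)

    flag-intersection : ∀ e → flag (intersection e) ≋ᵉ e
    flag-intersection (u , v , (g , k , inj₁ (p , q)) , x , x∈u , x∈v) = inj₁
      ( ≋-trans (left x) (left g) u (∈left⇒≋ (proj₁ p x∈u)) (≈-sym {u} {left g} p)
      , ≋-trans (right x) (right k) v (∈right⇒≋ (proj₁ q x∈v)) (≈-sym {v} {right k} q) )
    -- Here the edge is stored with its coset of `K` first, which equality of edges forgets.
    flag-intersection (u , v , (g , k , inj₂ (p , q)) , x , x∈u , x∈v) = inj₂
      ( ≋-trans (left x) (left g) v (∈left⇒≋ (proj₁ q x∈v)) (≈-sym {v} {left g} q)
      , ≋-trans (right x) (right k) u (∈right⇒≋ (proj₁ p x∈u)) (≈-sym {u} {right k} p) )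

    module _ {r} (conn : ConnectionSet G r) where
      private
        module C = ConnectionSet conn

      -- The flags of `g` and `k` share their coset of `H` exactly when `k ∙ g ⁻¹` lies in `H`, and
      -- likewise for `K`. Leaving `ε` out of `S` corresponds to adjacent edges being distinct.
      cayley≅lineGraph :
        (∀ {x} → x ∈ C.S → x ∈ Subgroup.Mem H ⊎ x ∈ Subgroup.Mem K) →
        (∀ {x} → x ∈ Subgroup.Mem H ⊎ x ∈ Subgroup.Mem K → ¬ x ≈ ε → x ∈ C.S) →
        Cay G conn ≅ Line
      cayley≅lineGraph S⊆ ⊆S = record
        { bijection = record
          { to = flag
          ; from = intersection
          ; to-cong = flag-cong
          ; from-cong = λ {e} {f} → intersection-cong e f
          ; inverse =
              (λ {e} {g} g≈e → Setoid.trans (Graph.vertices Line) {flag g} {flag (intersection e)} {e}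
                (flag-cong g≈e) (flag-intersection e))
            , (λ {g} {e} e≋g → intersection-cong e (flag g) e≋g)
          }
        ; adj⇔ = λ g k → mk⇔ (cay⇒line g k) (line⇒cay g k)
        }
        where
        cay⇒line : ∀ g k → (k ∙ g ⁻¹) ∈ C.S → Graph.Adj Line (flag g) (flag k)
        cay⇒line g k s =
            (λ fg≋fk → C.ε∉S (C.S-resp (x≈y⇒x∙y⁻¹≈ε (sym (intersection-cong (flag g) (flag k) fg≋fk))) s))
          , [ (λ s∈H → left g , inj₁ (≋-refl (left g)) ,
                inj₁ (≈-sym {left k} {left g} (∈left⇒≋ (quotient⇒∈-coset G H s∈H))))
            , (λ s∈K → right g , inj₂ (≋-refl (right g)) ,
                inj₂ (≈-sym {right k} {right g} (∈right⇒≋ (quotient⇒∈-coset G K s∈K)))) ]′ (S⊆ s)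

        line⇒cay : ∀ g k → Graph.Adj Line (flag g) (flag k) → (k ∙ g ⁻¹) ∈ C.S
        line⇒cay g k (fg≉fk , w , w-g , w-k) =
          ⊆S (common w-g w-k) (λ eq → fg≉fk (flag-cong (sym (x∙y⁻¹≈ε⇒x≈y k g eq))))
          where
          common : _IsEndOf_ Σ w (flag g) → _IsEndOf_ Σ w (flag k) →
                   (k ∙ g ⁻¹) ∈ Subgroup.Mem H ⊎ (k ∙ g ⁻¹) ∈ Subgroup.Mem K
          common (inj₁ (w⊆ , _)) (inj₁ (_ , ⊆w)) = inj₁
            (same-coset⇒quotient G H (w⊆ (⊆w (∈-coset-self G H k))) (∈-coset-self G H g))
          common (inj₂ (w⊆ , _)) (inj₂ (_ , ⊆w)) = inj₂
            (same-coset⇒quotient G K (w⊆ (⊆w (∈-coset-self G K k))) (∈-coset-self G K g))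
          -- In the mixed cases the shared end would be a coset of both `H` and `K`.
          common (inj₁ p) (inj₂ q) = ⊥-elim (left≋̸right {g} {k}
            (≋-trans (left g) w (right k) (≈-sym {w} {left g} p) q))
          common (inj₂ p) (inj₁ q) = ⊥-elim (left≋̸right {k} {g}
            (≋-trans (left k) w (right g) (≈-sym {w} {left k} q) p))

-- Homomorphisms out of a presented group.

module _ {X : Set} (G : Group o ℓ) where
  open Group G
  open RawGroupOps rawGroup
  private
    module T = RawGroupOps (termRawGroup X)

  eval : (X → Carrier) → Term X → Carrier
  eval f (gen x)  = f x
  eval f 1ᵗ       = ε
  eval f (s ∙ᵗ t) = eval f s ∙ eval f t
  eval f (s ⁻¹ᵗ)  = eval f s ⁻¹

  eval-^ : ∀ f t n → eval f (t T.^ n) ≡ eval f t ^ n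
  eval-^ f t zero    = ≡.refl
  eval-^ f t (suc n) = ≡.cong (eval f t ∙_) (eval-^ f t n)

  -- Von Dyck's theorem: an assignment of the generators that satisfies the relations extends to a
  -- homomorphism.
  eval-cong : ∀ {R f} → (∀ {s t} → R s t → eval f s ≈ eval f t) →
              ∀ {s t} → Derivable R s t → eval f s ≈ eval f t
  eval-cong rel (relᵈ r)         = rel r
  eval-cong rel reflᵈ            = refl
  eval-cong rel (symᵈ d)         = sym (eval-cong rel d)
  eval-cong rel (transᵈ d d′)    = trans (eval-cong rel d) (eval-cong rel d′)
  eval-cong rel (∙-congᵈ d d′)   = ∙-cong (eval-cong rel d) (eval-cong rel d′)
  eval-cong rel (⁻¹-congᵈ d)     = ⁻¹-cong (eval-cong rel d)
  eval-cong rel (assocᵈ _ _ _)   = assoc _ _ _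
  eval-cong rel (identityˡᵈ _)   = identityˡ _
  eval-cong rel (identityʳᵈ _)   = identityʳ _
  eval-cong rel (inverseˡᵈ _)    = inverseˡ _
  eval-cong rel (inverseʳᵈ _)    = inverseʳ _

module _ {X : Set} (R : Rel (Term X) 0ℓ) where
  private
    G′ : Group 0ℓ 0ℓ
    G′ = presentedGroup R
  open Group G′

  -- Both sides are multiplicative in `t`, so being inverse need only be checked on generators.
  eval∘eval : ∀ {f g} → (∀ x → eval G′ f (g x) ≈ gen x) → ∀ t → eval G′ f (eval G′ g t) ≈ t
  eval∘eval fg (gen x)  = fg x
  eval∘eval fg 1ᵗ       = refl
  eval∘eval fg (s ∙ᵗ t) = ∙-cong (eval∘eval fg s) (eval∘eval fg t)
  eval∘eval fg (s ⁻¹ᵗ)  = ⁻¹-cong (eval∘eval fg s)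

  eval-generated : ∀ {f x} (L : Subgroup G′ h) →
    (∀ {s t} → s ≈ t → eval G′ f s ≈ eval G′ f t) → eval G′ f x ∈ Subgroup.Mem L →
    ∀ {y} → Generated G′ x y → eval G′ f y ∈ Subgroup.Mem L
  eval-generated L cong fx base = fx
  eval-generated L cong fx unit = Subgroup.ε-mem L
  eval-generated L cong fx (prod m n) =
    Subgroup.∙-mem L (eval-generated L cong fx m) (eval-generated L cong fx n)
  eval-generated L cong fx (inv m) = Subgroup.⁻¹-mem L (eval-generated L cong fx m)
  eval-generated L cong fx (≈-resp e m) = Subgroup.Mem-resp L (cong e) (eval-generated L cong fx m)

-- The Heisenberg group modulo `p` and its automorphisms.

module Heisenberg (p : ℕ) (p-prime : Prime p) where
  open Group (G p)
  open RawGroupOps rawGroup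
  open PowersAndCommutators (G p)
  open MonoidMult monoid using (×-homo-+)
  open GroupProperties (G p) using (x∙y⁻¹≈ε⇒x≈y; //-rightDividesˡ)
  open CosetGraph (G p) (⟨a⟩ p) (⟨b⟩ p) (⟨a⟩≢⟨b⟩ p p-prime) public

  private
    instance
      p-nonZero : NonZero p
      p-nonZero = prime⇒nonZero p-prime

    1<p : 1 < p
    1<p = ℕ.nonTrivial⇒n>1 p {{prime⇒nonTrivial p-prime}}

  c^p≈ε : c ^ p ≈ ε
  c^p≈ε = trans (reflexive (^-agree p c p)) (relᵈ cᵖ≡1)

  inverse-modulo-p : ∀ i .{{_ : NonZero i}} → i < p →
                     ∃[ k ] ∃[ m ] ∃[ n ] k ℕ.* i ℕ.+ m ℕ.* p ≡ 1 ℕ.+ n ℕ.* p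
  inverse-modulo-p i i<p with coprime-Bézout (prime⇒coprime p-prime i<p)
  ... | Bézout.-+ x y eq = y , 0 , x , ≡.trans (ℕₚ.+-identityʳ _) (≡.sym eq)
  -- Here y i ≡ −1 modulo p, so (p − 1) y is inverse to i.
  ... | Bézout.+- x y eq = ℕ.pred p ℕ.* y , 1 , ℕ.pred p ℕ.* x , (begin
      ℕ.pred p ℕ.* y ℕ.* i ℕ.+ 1 ℕ.* p                  ≡⟨ ≡.cong (λ m → ℕ.pred p ℕ.* y ℕ.* i ℕ.+ 1 ℕ.* m) (ℕₚ.suc-pred p) ⟨
      ℕ.pred p ℕ.* y ℕ.* i ℕ.+ 1 ℕ.* suc (ℕ.pred p)     ≡⟨ rearrange (ℕ.pred p) y i ⟩
      1 ℕ.+ ℕ.pred p ℕ.* (1 ℕ.+ y ℕ.* i)                ≡⟨ ≡.cong (λ m → 1 ℕ.+ ℕ.pred p ℕ.* m) eq ⟩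
      1 ℕ.+ ℕ.pred p ℕ.* (x ℕ.* p)                      ≡⟨ ≡.cong suc (ℕₚ.*-assoc (ℕ.pred p) x p) ⟨
      1 ℕ.+ ℕ.pred p ℕ.* x ℕ.* p                        ∎)
    where
    open ≡.≡-Reasoning
    rearrange : ∀ q y i → q ℕ.* y ℕ.* i ℕ.+ 1 ℕ.* suc q ≡ 1 ℕ.+ q ℕ.* (1 ℕ.+ y ℕ.* i)
    rearrange = solve-∀

  assign : Term Gen → Term Gen → Term Gen → Gen → Term Gen
  assign x y z a′ = x
  assign x y z b′ = y
  assign x y z c′ = z

  extend : (Gen → Term Gen) → Term Gen → Term Gen
  extend = eval (G p)

  extend-^ : ∀ f t n → extend f (t ^ n) ≡ extend f t ^ n
  extend-^ f t n = ≡.trans (≡.cong (extend f) (^-agree p t n)) (eval-^ (G p) f t n)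

  Respects : (Gen → Term Gen) → Set
  Respects f = ∀ {s t} → Relator p s t → extend f s ≈ extend f t

  assign-respects : ∀ {x y z} → x ^ p ≈ ε → y ^ p ≈ ε → z ^ p ≈ ε →
                    [ x , y ] ≈ z → [ z , x ] ≈ ε → [ z , y ] ≈ ε → Respects (assign x y z)
  assign-respects xᵖ yᵖ zᵖ xy zx zy aᵖ≡1    = trans (reflexive (eval-^ (G p) _ a p)) xᵖ
  assign-respects xᵖ yᵖ zᵖ xy zx zy bᵖ≡1    = trans (reflexive (eval-^ (G p) _ b p)) yᵖ
  assign-respects xᵖ yᵖ zᵖ xy zx zy cᵖ≡1    = trans (reflexive (eval-^ (G p) _ c p)) zᵖ
  assign-respects xᵖ yᵖ zᵖ xy zx zy [a,b]≡c = xy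
  assign-respects xᵖ yᵖ zᵖ xy zx zy [c,a]≡1 = zx
  assign-respects xᵖ yᵖ zᵖ xy zx zy [c,b]≡1 = zy

  -- Reduces an automorphism acting on the coset graph to finitely many checks on relators and
  -- generators.
  substitution : ∀ d (f g : Gen → Term Gen) → Respects f → Respects g →
    (∀ x → extend f (g x) ≈ gen x) → (∀ x → extend g (f x) ≈ gen x) →
    f a′ ∈ Subgroup.Mem (leftImage d) → f b′ ∈ Subgroup.Mem (rightImage d) →
    g a′ ∈ Subgroup.Mem (leftImage d) → g b′ ∈ Subgroup.Mem (rightImage d) →
    CosetSymmetry d
  substitution d f g f-resp g-resp fg gf fa fb ga gb = record
    { to = extend f
    ; from = extend g
    ; to-cong = f-cong
    ; from-cong = g-cong
    ; to∘from = eval∘eval (Relator p) fg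
    ; from∘to = eval∘eval (Relator p) gf
    -- `eval` computes on products, so multiplicativity is reflexivity.
    ; to-mem = homomorphism-mem d f-cong (λ _ _ → refl)
        (eval-generated (Relator p) (leftImage d) f-cong fa)
        (eval-generated (Relator p) (rightImage d) f-cong fb)
    ; from-mem = homomorphism-mem d g-cong (λ _ _ → refl)
        (eval-generated (Relator p) (leftImage d) g-cong ga)
        (eval-generated (Relator p) (rightImage d) g-cong gb)
    }
    where
    f-cong : ∀ {s t} → s ≈ t → extend f s ≈ extend f t
    f-cong = eval-cong (G p) f-resp
    g-cong : ∀ {s t} → s ≈ t → extend g s ≈ extend g t
    g-cong = eval-cong (G p) g-resp

  -- Exchanging `a` and `b` inverts their commutator, which forces the image of `c`.
  σ : Gen → Term Gen
  σ = assign b a (c ⁻¹)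

  exchange : CosetSymmetry flip
  exchange = substitution flip σ σ σ-respects σ-respects σσ σσ base base base base
    where
    σ-respects : Respects σ
    σ-respects = assign-respects (bᵖ p) (aᵖ p) (x^n≈ε⇒[x⁻¹]^n≈ε p c^p≈ε)
      (commutator-swap (relᵈ [a,b]≡c))
      (commuting⇐ (commuting-⁻¹ (commuting⇒ (relᵈ [c,b]≡1))))
      (commuting⇐ (commuting-⁻¹ (commuting⇒ (relᵈ [c,a]≡1))))

    σσ : ∀ x → extend σ (σ x) ≈ gen x
    σσ a′ = refl
    σσ b′ = refl
    σσ c′ = GroupProperties.⁻¹-involutive (G p) c

  power∈generated : ∀ x n → x ^ n ∈ Generated (G p) x
  power∈generated x zero    = unit
  power∈generated x (suc n) = prod base (power∈generated x n)

  -- The image of `c` is forced by `[ a ^ i , b ] ≈ c ^ i`, which holds as `c` commutes with `a`.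
  δ : ℕ → Gen → Term Gen
  δ i = assign (a ^ i) b (c ^ i)

  δ-respects : ∀ i → Respects (δ i)
  δ-respects i = assign-respects
    (x^n≈ε⇒[x^m]^n≈ε {n = p} (aᵖ p) i) (bᵖ p) (x^n≈ε⇒[x^m]^n≈ε {n = p} c^p≈ε i)
    (commutator-^ (relᵈ [a,b]≡c) ca i)
    -- The inner use of `commuting-^` raises `a` to the power `i`, the outer one raises `c`.
    (commuting⇐ (commuting-^ (sym (commuting-^ (sym ca) i)) i))
    (commuting⇐ (commuting-^ (commuting⇒ (relᵈ [c,b]≡1)) i))
    where
    ca : c ∙ a ≈ a ∙ c
    ca = commuting⇒ (relᵈ [c,a]≡1)

  δ∘δ : ∀ i k {m n} → k ℕ.* i ℕ.+ m ℕ.* p ≡ 1 ℕ.+ n ℕ.* p → ∀ x → extend (δ i) (δ k x) ≈ gen x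
  δ∘δ i k {m} {n} ki a′ = trans (reflexive (extend-^ (δ i) a k)) (x^n≈ε⇒[x^i]^k≈x {l = m} {n} (aᵖ p) k i ki)
  δ∘δ i k         ki b′ = refl
  δ∘δ i k {m} {n} ki c′ = trans (reflexive (extend-^ (δ i) c k)) (x^n≈ε⇒[x^i]^k≈x {l = m} {n} c^p≈ε k i ki)

  dilation : ∀ i .{{_ : NonZero i}} → i < p → CosetSymmetry keep
  dilation i i<p = let k , m , n , ki = inverse-modulo-p i i<p in
        substitution keep (δ i) (δ k) (δ-respects i) (δ-respects k)
          (δ∘δ i k {m} {n} ki)
          -- Being inverse modulo `p` is symmetric in `i` and `k`, so one congruence serves both
          -- composites.
          (δ∘δ k i {m} {n} (≡.trans (≡.cong (ℕ._+ m ℕ.* p) (ℕₚ.*-comm i k)) ki))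
          (power∈generated a i) base (power∈generated a k) base

  generated⇒power : ∀ {x y} → x ^ p ≈ ε → y ∈ Generated (G p) x → ∃[ n ] (n < p × y ≈ x ^ n)
  generated⇒power {x} xᵖ = power
    where
    reduce : ∀ {y} n → y ≈ x ^ n → ∃[ n ] (n < p × y ≈ x ^ n)
    reduce n eq = n % p , m%n<n n p , trans eq (^-mod xᵖ n)

    power : ∀ {y} → y ∈ Generated (G p) x → ∃[ n ] (n < p × y ≈ x ^ n)
    power base = reduce 1 (sym (identityʳ x))
    power unit = reduce 0 refl
    power (prod y z) with power y | power z
    ... | m , _ , eq | n , _ , eq′ = reduce (m ℕ.+ n) (trans (∙-cong eq eq′) (sym (×-homo-+ x m n)))
    power (inv y) with power y
    -- The bound carried through the induction makes the truncated `p ∸ m` a true difference.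
    ... | m , m<p , eq = reduce (p ∸ m) (trans (⁻¹-cong eq) (^-inv p x xᵖ m (ℕₚ.<⇒≤ m<p)))
    power (≈-resp e y) with power y
    ... | m , m<p , eq = m , m<p , trans (sym e) eq

  generated⇒nonzero-power : ∀ {x y} → x ^ p ≈ ε → y ∈ Generated (G p) x → ¬ y ≈ ε →
                            ∃[ n ] (NonZero n × n < p × y ≈ x ^ n)
  generated⇒nonzero-power xᵖ y∈ y≉ε with generated⇒power xᵖ y∈
  ... | zero  , _   , eq = ⊥-elim (y≉ε eq)
  ... | suc n , n<p , eq = suc n , _ , n<p , eq

  -- The exponent sum of `a` modulo `p` is an invariant, with value `n` on `a ^ n` and 0 on every
  -- power of `b`. Hence `p` divides `n`, impossible for `0 < n < p`.
  ⟨a⟩∩⟨b⟩ : ∀ {x} → x ∈ Subgroup.Mem (⟨a⟩ p) → x ∈ Subgroup.Mem (⟨b⟩ p) → x ≈ ε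
  ⟨a⟩∩⟨b⟩ x∈a x∈b with generated⇒power (aᵖ p) x∈a | generated⇒power (bᵖ p) x∈b
  ... | zero  , _   , eq | _ = eq
  ... | n@(suc _) , n<p , eq | m , _ , eq′ with W.w-resp (trans (sym eq) eq′)
    where module W = Weight p 1ℤ 0ℤ
  ... | q , wⁿ = ⊥-elim (ℕₚ.<⇒≱ n<p (ℕ∣.∣⇒≤ (≋0⇒∣ p n q (begin
      + n                             ≡⟨ ℤₚ.*-identityʳ (+ n) ⟨
      + n ℤ.* 1ℤ                      ≡⟨ w-^ a n ⟨
      W.w (a ^ n)                     ≡⟨ wⁿ ⟩
      W.w (b ^ m) ℤ.+ q ℤ.* + p       ≡⟨ ≡.cong (ℤ._+ q ℤ.* + p) (≡.trans (w-^ b m) (ℤₚ.*-zeroʳ (+ m))) ⟩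
      0ℤ ℤ.+ q ℤ.* + p                ∎))))
    where
    module W = Weight p 1ℤ 0ℤ
    open ≡.≡-Reasoning
    w-^ : ∀ x n → W.w (x ^ n) ≡ + n ℤ.* W.w x
    w-^ x n = ≡.trans (≡.cong W.w (^-agree p x n)) (W.w-^ x n)

  cayley : Cay (G p) (connS p) ≅ LineGraph Σ
  cayley = cayley≅lineGraph ⟨a⟩∩⟨b⟩ (connS p)
    (λ { (n , _ , _ , inj₁ eq) → inj₁ (≈-resp (sym eq) (power∈generated a n))
       ; (n , _ , _ , inj₂ eq) → inj₂ (≈-resp (sym eq) (power∈generated b n)) })
    ⊆S
    where
    ⊆S : ∀ {x} → x ∈ Subgroup.Mem (⟨a⟩ p) ⊎ x ∈ Subgroup.Mem (⟨b⟩ p) → ¬ x ≈ ε → S p x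
    ⊆S (inj₁ x∈a) x≉ε with generated⇒nonzero-power (aᵖ p) x∈a x≉ε
    ... | n , n≢0 , n<p , eq = n , ℕ.>-nonZero⁻¹ n {{n≢0}} , ℕₚ.<⇒≤pred n<p , inj₁ eq
    ⊆S (inj₂ x∈b) x≉ε with generated⇒nonzero-power (bᵖ p) x∈b x≉ε
    ... | n , n≢0 , n<p , eq = n , ℕ.>-nonZero⁻¹ n {{n≢0}} , ℕₚ.<⇒≤pred n<p , inj₂ eq

  -- The 3-arcs of the coset graph.

  baseArc : Arc Σ 3
  baseArc = path₃ (right a) (left ε) (right ε) (left b)
    (symm {left ε} {right a} (adj-left-right (in-subgroup (⟨a⟩ p) base) (∈-coset-self (G p) (⟨b⟩ p) a)))
    (adj-left-right (∈-coset-self (G p) (⟨a⟩ p) ε) (∈-coset-self (G p) (⟨b⟩ p) ε))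
    (symm {left b} {right ε} (adj-left-right (∈-coset-self (G p) (⟨a⟩ p) b) (in-subgroup (⟨b⟩ p) base)))
    -- If the cosets of `a` and `ε` agreed, `a` would lie in both subgroups and be trivial. The
    -- exponent 1 is in range as `1 < p`, and `a ^ 1` unfolds to `a ∙ ε`.
    (λ (a⊆ , _) → ^≉ε p a ≡.refl 1 ℕₚ.≤-refl (ℕₚ.<⇒≤pred 1<p)
      (trans (sym (⟨a⟩∩⟨b⟩ base (out-subgroup (⟨b⟩ p) (a⊆ (∈-coset-self (G p) (⟨b⟩ p) a)))))
        (sym (identityʳ a))))
    (λ (_ , b⊆) → ^≉ε p b ≡.refl 1 ℕₚ.≤-refl (ℕₚ.<⇒≤pred 1<p)
      (trans (sym (⟨a⟩∩⟨b⟩ (out-subgroup (⟨a⟩ p) (b⊆ (∈-coset-self (G p) (⟨a⟩ p) b))) base))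
        (sym (identityʳ b))))
    where
    in-subgroup : ∀ (L : Subgroup (G p) 0ℓ) {x} → x ∈ Subgroup.Mem L → x ∈ _·_ (G p) L ε
    in-subgroup L x∈L = _ , x∈L , sym (identityʳ _)
    out-subgroup : ∀ (L : Subgroup (G p) 0ℓ) {x} → x ∈ _·_ (G p) L ε → x ∈ Subgroup.Mem L
    out-subgroup L (m , m∈L , x≈mε) = Subgroup.Mem-resp L (sym (trans x≈mε (identityʳ m))) m∈L

  -- Conjugating a dilation by the exchange scales b instead of a.
  arcMap : ∀ i .{{_ : NonZero i}} → i < p → ∀ j .{{_ : NonZero j}} → j < p → Term Gen → Aut Σ
  arcMap i i<p j j<p y =
    ≅-trans (automorphism exchange) (≅-trans (automorphism (dilation j j<p))
      (≅-trans (automorphism exchange) (≅-trans (automorphism (dilation i i<p))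
        (automorphism (translation y)))))

  -- Relates the group elements of two distinct edges with a common end: `s` generates the subgroup
  -- of that end, and the exponent found is the one by which `arcMap` must dilate.
  neighbour-shift : ∀ {s x y} → s ^ p ≈ ε → (x ∙ y ⁻¹) ∈ Generated (G p) s → ¬ x ≈ y →
                    ∃[ n ] (NonZero n × n < p × x ≈ s ^ n ∙ y)
  neighbour-shift {s} {x} {y} sᵖ xy⁻¹∈ x≉y
    with generated⇒nonzero-power sᵖ xy⁻¹∈ (x≉y ∘ x∙y⁻¹≈ε⇒x≈y x y)
  ... | n , n≢0 , n<p , eq = n , n≢0 , n<p , trans (sym (//-rightDividesˡ y x)) (∙-congʳ eq)

  -- The left side is the image of `b` under `arcMap` before translation. That of `a` computes to
  -- `a ^ i`, but here the power has to be pulled out of both substitutions.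
  arcMap-b : ∀ i j → extend (δ i) (extend σ (a ^ j)) ≈ b ^ j
  arcMap-b i j = reflexive (≡.trans (≡.cong (extend (δ i)) (extend-^ σ a j)) (extend-^ (δ i) b j))

  Reaches : Aut Σ → (v₀ v₁ v₂ v₃ : Coset (G p) (⟨a⟩ p) (⟨b⟩ p)) → Set
  Reaches φ v₀ v₁ v₂ v₃ =
    to (right a) ≋ v₀ × to (left ε) ≋ v₁ × to (right ε) ≋ v₂ × to (left b) ≋ v₃
    where open _≅_ φ

  reach : ∀ v₀ v₁ v₂ v₃ → Adj v₀ v₁ → Adj v₁ v₂ → Adj v₂ v₃ → v₀ ≋̸ v₂ → v₁ ≋̸ v₃ →
          ∃[ φ ] Reaches φ v₀ v₁ v₂ v₃
  -- The graph is bipartite, so only the two alternating patterns of tags survive.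
  reach (left _)  (left _)  _ _ v₀~v₁ _ _ _ _ = ⊥-elim (¬adj-left-left v₀~v₁)
  reach (right _) (right _) _ _ v₀~v₁ _ _ _ _ = ⊥-elim (¬adj-right-right v₀~v₁)
  reach (right _) (left _)  (left _)  _ _ v₁~v₂ _ _ _ = ⊥-elim (¬adj-left-left v₁~v₂)
  reach (left _)  (right _) (right _) _ _ v₁~v₂ _ _ _ = ⊥-elim (¬adj-right-right v₁~v₂)
  reach (right _) (left _)  (right _) (right _) _ _ v₂~v₃ _ _ = ⊥-elim (¬adj-right-right v₂~v₃)
  reach (left _)  (right _) (left _)  (left _)  _ _ v₂~v₃ _ _ = ⊥-elim (¬adj-left-left v₂~v₃)
  reach (right k) (left g) (right h) (left l)
        (_ , x , x∈k , x∈g) (_ , y , y∈g , y∈h) (_ , z , z∈h , z∈l) v₀≉v₂ v₁≉v₃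
    -- The elements `x`, `y`, `z` represent the three edges. If `x ≈ y`, the cosets `v₀` and `v₂`
    -- would meet and so coincide; `z ≈ y` would likewise identify `v₁` and `v₃`.
    with neighbour-shift {a} (aᵖ p) (same-coset⇒quotient (G p) (⟨a⟩ p) x∈g y∈g)
           (λ x≈y → v₀≉v₂ (same-right x∈k (∈-coset-resp (G p) (⟨b⟩ p) (sym x≈y) y∈h)))
       | neighbour-shift {b} (bᵖ p) (same-coset⇒quotient (G p) (⟨b⟩ p) z∈h y∈h)
           (λ z≈y → v₁≉v₃ (same-left (∈-coset-resp (G p) (⟨a⟩ p) (sym z≈y) y∈g) z∈l))
  ... | i , i≢0 , i<p , x≈ | j , j≢0 , j<p , z≈ =
      arcMap i {{i≢0}} i<p j {{j≢0}} j<p y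
    , right-of (sym x≈) x∈k
    , left-of (identityˡ y) y∈g
    , right-of (identityˡ y) y∈h
    , left-of (trans (∙-congʳ (arcMap-b i j)) (sym z≈)) z∈l
  reach (left k) (right g) (left h) (right l)
        (_ , x , x∈k , x∈g) (_ , y , y∈g , y∈h) (_ , z , z∈h , z∈l) v₀≉v₂ v₁≉v₃
    with neighbour-shift {b} (bᵖ p) (same-coset⇒quotient (G p) (⟨b⟩ p) x∈g y∈g)
           (λ x≈y → v₀≉v₂ (same-left x∈k (∈-coset-resp (G p) (⟨a⟩ p) (sym x≈y) y∈h)))
       | neighbour-shift {a} (aᵖ p) (same-coset⇒quotient (G p) (⟨a⟩ p) z∈h y∈h)
           (λ z≈y → v₁≉v₃ (same-right (∈-coset-resp (G p) (⟨b⟩ p) (sym z≈y) y∈g) z∈l))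
  ... | j , j≢0 , j<p , x≈ | i , i≢0 , i<p , z≈ =
      -- The initial exchange carries the base arc to its own reversal, so `j` now belongs to `v₀`
      -- and `i` to `v₃`.
      ≅-trans (automorphism exchange) (arcMap i {{i≢0}} i<p j {{j≢0}} j<p y)
    , left-of (trans (∙-congʳ (arcMap-b i j)) (sym x≈)) x∈k
    , right-of (identityˡ y) y∈g
    , left-of (identityˡ y) y∈h
    , right-of (sym z≈) z∈l

  arcTransitive : ArcTransitive Σ 3
  arcTransitive = arcTransitive-from baseArc λ β →
    let open Arc β
        v₀ = at zero
        v₁ = at (suc zero)
        v₂ = at (suc (suc zero))
        v₃ = at (suc (suc (suc zero)))
        φ , e₀ , e₁ , e₂ , e₃ = reach v₀ v₁ v₂ v₃
          (consecutive zero (suc zero) ≡.refl)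
          (consecutive (suc zero) (suc (suc zero)) ≡.refl)
          (consecutive (suc (suc zero)) (suc (suc (suc zero))) ≡.refl)
          (noBacktrack zero (suc (suc zero)) ≡.refl)
          (noBacktrack (suc zero) (suc (suc (suc zero))) ≡.refl)
    in φ , λ { zero → e₀ ; (suc zero) → e₁ ; (suc (suc zero)) → e₂ ; (suc (suc (suc zero))) → e₃ }

corollary1p3 : (p : ℕ) (p-prime : Prime p) → ¬ (2 ∣ p) →
    let Σ = Cos (G p) (⟨a⟩ p) (⟨b⟩ p) (⟨a⟩≢⟨b⟩ p p-prime)
    in (Cay (G p) (connS p) ≅ LineGraph Σ) × ArcTransitive Σ 3
corollary1p3 p p-prime _ = cayley , arcTransitive
  where open Heisenberg p p-prime
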